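{- Let $\gamma \geq 0$ be an integer. The vector space of $\gamma$-edge valued binary trees (with at least one internal node), endowed with the operations $\prec_a, \succ_a$, $a \in [\gamma]$, defined recursively in the context, is the free $\gamma$-polydendriform algebra over one generator.
   Context: The ground field has characteristic zero; $[\gamma] = \{1, \dots, \gamma\}$; $a \downarrow a' := \min(a, a')$. A $\gamma$-polydendriform algebra is an algebra over the operad $\mathsf{Dendr}_\gamma$; equivalently, a vector space with binary linear operations $\prec_a, \succ_a$, $a \in [\gamma]$, satisfying for all elements $x, y, z$ and all $a, a' \in [\gamma]$: $(x \succ_{a'} y) \prec_a z = x \succ_{a'} (y \prec_a z)$; $(x \prec_{a'} y) \prec_a z = x \prec_{a \downarrow a'} (y \prec_a z) + x \prec_{a \downarrow a'} (y \succ_{a'} z)$; $(x \prec_{a'} y) \succ_{a \downarrow a'} z + (x \succ_a y) \succ_{a \downarrow a'} z = x \succ_a (y \succ_{a'} z)$. Free over one generator is meant in the category of such algebras (morphisms: linear maps commuting with all operations). A $\gamma$-edge valued binary tree is a planar binary tree (each internal node has exactly two children) with at least one internal node, in which every edge connecting two internal nodes is labeled by an element of $[\gamma]$. By convention, all edges connecting internal nodes with leaves are labeled by $\infty$, with $a \downarrow \infty = a = \infty \downarrow a$ for $a \in [\gamma]$. Denote by $\perp$ the leaf, and by $B(x, y; \mathfrak{t}_1, \mathfrak{t}_2)$ the tree whose root has left subtree $\mathfrak{t}_1$ attached by an edge labeled $x$ and right subtree $\mathfrak{t}_2$ attached by an edge labeled $y$ (extended bilinearly in $\mathfrak{t}_1,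 \mathfrak{t}_2$). The operations are defined linearly and recursively, for any $\gamma$-edge valued binary tree $\mathfrak{s}$ and any $\gamma$-edge valued binary trees or leaves $\mathfrak{t}_1, \mathfrak{t}_2$, by $\mathfrak{s} \prec_a \perp := \mathfrak{s} =: \perp \succ_a \mathfrak{s}$ and $\perp \prec_a \mathfrak{s} := 0 =: \mathfrak{s} \succ_a \perp$ (also for index $a = \infty$, which occurs in the recursion only when one operand is a leaf); $B(x, y; \mathfrak{t}_1, \mathfrak{t}_2) \prec_a \mathfrak{s} := B(x, z; \mathfrak{t}_1, \mathfrak{t}_2 \prec_a \mathfrak{s}) + B(x, z; \mathfrak{t}_1, \mathfrak{t}_2 \succ_y \mathfrak{s})$ with $z := a \downarrow y$; $\mathfrak{s} \succ_a B(x, y; \mathfrak{t}_1, \mathfrak{t}_2) := B(z, y; \mathfrak{s} \succ_a \mathfrak{t}_1, \mathfrak{t}_2) + B(z, y; \mathfrak{s} \prec_x \mathfrak{t}_1, \mathfrak{t}_2)$ with $z := a \downarrow x$. ($\perp \prec_a \perp$ and $\perp \succ_a \perp$ are not defined and never needed.) -}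

module Defs where

open import Algebra.Apartness.Bundles using (HeytingField; HeytingCommutativeRing)
open import Algebra.Bundles using (CommutativeRing)
open import Algebra.Module.Bundles using (Module)
open import Algebra.Module.Structures.Biased using (IsModuleFromLeft)
import Algebra.Construct.NaturalChoice.Min as Min
import Algebra.Definitions.RawMonoid as RawMonoidDefinitions
import Algebra.Module.Morphism.Structures as ModuleMorphism
import Algebra.Properties.AbelianGroup as AbelianGroupProperties
import Relation.Binary.Reasoning.Setoid as SetoidReasoning
open import Data.Bool.Base using (true; false; if_then_else_)
open import Data.Fin.Base using (Fin)
import Data.Fin.Properties as Fin
open import Data.List.Base using (List; []; _∷_; [_]; _++_; map; concatMap)
open import Data.Nat.Base using (ℕ; suc)
open import Data.Product using (∃!)
open import Data.Product.Base using (_×_; _,_; map₁; map₂)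
open import Level using (Level; _⊔_; Setω) renaming (suc to lsuc)
open import Relation.Binary.Core using (Rel)
open import Relation.Binary.Definitions using (DecidableEquality)
open import Relation.Binary.PropositionalEquality.Core using (refl)
open import Relation.Nullary using (¬_; yes; no; does)

private
  variable
    c ℓ₁ ℓ₂ m m′ ℓ ℓ′ : Level
    γ : ℕ

------------------------------------------------------------------------
-- Fields and vector spaces

fieldRing : HeytingField c ℓ₁ ℓ₂ → CommutativeRing c ℓ₁
fieldRing K = HeytingCommutativeRing.commutativeRing (HeytingField.heytingCommutativeRing K)

CharacteristicZero : HeytingField c ℓ₁ ℓ₂ → Set ℓ₁
CharacteristicZero K = ∀ n → ¬ (suc n · 1#) ≈ 0#
  where
  open CommutativeRing (fieldRing K)
  open RawMonoidDefinitions +-rawMonoid using () renaming (_×_ to _·_)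

VectorSpace : HeytingField c ℓ₁ ℓ₂ → ∀ m ℓ → Set (c ⊔ ℓ₁ ⊔ lsuc (m ⊔ ℓ))
VectorSpace K = Module (fieldRing K)

module _ (K : HeytingField c ℓ₁ ℓ₂) where

  IsLinear : (V : VectorSpace K m ℓ) (W : VectorSpace K m′ ℓ′) →
             (Module.Carrierᴹ V → Module.Carrierᴹ W) → Set (c ⊔ m ⊔ ℓ ⊔ ℓ′)
  IsLinear V W = IsModuleHomomorphism
    where open ModuleMorphism.ModuleMorphisms (Module.rawModule V) (Module.rawModule W)

------------------------------------------------------------------------
-- The vector space with basis A: finite formal linear combinations,
-- identified when they have the same coefficients

module FreeVectorSpace (K : HeytingField c ℓ₁ ℓ₂)
                       {A : Set} (_≟_ : DecidableEquality A) where

  open CommutativeRing (fieldRing K) hiding (zero; _-_)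
    renaming (Carrier to ∣K∣; refl to ≈-refl; sym to ≈-sym; trans to ≈-trans)
  open SetoidReasoning setoid
  open AbelianGroupProperties +-abelianGroup using (⁻¹-∙-comm; ε⁻¹≈ε)

  Combination : Set c
  Combination = List (∣K∣ × A)

  basis : A → Combination
  basis t = [ 1# , t ]

  coeff : Combination → A → ∣K∣
  coeff []            t = 0#
  coeff ((r , s) ∷ u) t = (if does (s ≟ t) then r else 0#) + coeff u t

  infix 4 _≋_
  _≋_ : Rel Combination ℓ₁
  u ≋ v = ∀ t → coeff u t ≈ coeff v t

  infixr 7 _∙_
  _∙_ : ∣K∣ → Combination → Combination
  r ∙ u = map (map₁ (r *_)) u

  neg : Combination → Combination
  neg = map (map₁ (-_))

  bilinear : (A → A → Combination) → Combination → Combination → Combination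
  bilinear f u v =
    concatMap (λ (r , s) → concatMap (λ (q , t) → (r * q) ∙ f s t) v) u

  coeff-++ : ∀ u v t → coeff (u ++ v) t ≈ coeff u t + coeff v t
  coeff-++ []            v t = ≈-sym (+-identityˡ _)
  coeff-++ ((r , s) ∷ u) v t = ≈-trans (+-congˡ (coeff-++ u v t)) (≈-sym (+-assoc _ _ _))

  coeff-∙ : ∀ r u t → coeff (r ∙ u) t ≈ r * coeff u t
  coeff-∙ r []            t = ≈-sym (zeroʳ r)
  coeff-∙ r ((q , s) ∷ u) t with does (s ≟ t)
  ... | true  = ≈-trans (+-congˡ (coeff-∙ r u t)) (≈-sym (distribˡ r _ _))
  ... | false = ≈-trans (+-cong (≈-sym (zeroʳ r)) (coeff-∙ r u t)) (≈-sym (distribˡ r _ _))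

  coeff-neg : ∀ u t → coeff (neg u) t ≈ - coeff u t
  coeff-neg []            t = ≈-sym ε⁻¹≈ε
  coeff-neg ((q , s) ∷ u) t with does (s ≟ t)
  ... | true  = ≈-trans (+-congˡ (coeff-neg u t)) (⁻¹-∙-comm _ _)
  ... | false = ≈-trans (+-cong (≈-sym ε⁻¹≈ε) (coeff-neg u t)) (⁻¹-∙-comm _ _)

  private
    ++-cong : ∀ {u u′ v v′} → u ≋ u′ → v ≋ v′ → u ++ v ≋ u′ ++ v′
    ++-cong {u} {u′} {v} {v′} p q t = begin
      coeff (u ++ v) t         ≈⟨ coeff-++ u v t ⟩
      coeff u t + coeff v t    ≈⟨ +-cong (p t) (q t) ⟩
      coeff u′ t + coeff v′ t  ≈⟨ coeff-++ u′ v′ t ⟨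
      coeff (u′ ++ v′) t       ∎

    ++-assoc : ∀ u v w → (u ++ v) ++ w ≋ u ++ (v ++ w)
    ++-assoc u v w t = begin
      coeff ((u ++ v) ++ w) t              ≈⟨ coeff-++ (u ++ v) w t ⟩
      coeff (u ++ v) t + coeff w t         ≈⟨ +-congʳ (coeff-++ u v t) ⟩
      (coeff u t + coeff v t) + coeff w t  ≈⟨ +-assoc _ _ _ ⟩
      coeff u t + (coeff v t + coeff w t)  ≈⟨ +-congˡ (coeff-++ v w t) ⟨
      coeff u t + coeff (v ++ w) t         ≈⟨ coeff-++ u (v ++ w) t ⟨
      coeff (u ++ (v ++ w)) t              ∎

    ++-comm : ∀ u v → u ++ v ≋ v ++ u
    ++-comm u v t = begin
      coeff (u ++ v) t       ≈⟨ coeff-++ u v t ⟩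
      coeff u t + coeff v t  ≈⟨ +-comm _ _ ⟩
      coeff v t + coeff u t  ≈⟨ coeff-++ v u t ⟨
      coeff (v ++ u) t       ∎

    neg-inverseˡ : ∀ u → neg u ++ u ≋ []
    neg-inverseˡ u t = begin
      coeff (neg u ++ u) t         ≈⟨ coeff-++ (neg u) u t ⟩
      coeff (neg u) t + coeff u t  ≈⟨ +-congʳ (coeff-neg u t) ⟩
      - coeff u t + coeff u t      ≈⟨ -‿inverseˡ _ ⟩
      0#                           ∎

    neg-inverseʳ : ∀ u → u ++ neg u ≋ []
    neg-inverseʳ u t = ≈-trans (++-comm u (neg u) t) (neg-inverseˡ u t)

    neg-cong : ∀ {u v} → u ≋ v → neg u ≋ neg v
    neg-cong {u} {v} p t = begin
      coeff (neg u) t  ≈⟨ coeff-neg u t ⟩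
      - coeff u t      ≈⟨ -‿cong (p t) ⟩
      - coeff v t      ≈⟨ coeff-neg v t ⟨
      coeff (neg v) t  ∎

    ∙-cong : ∀ {r q u v} → r ≈ q → u ≋ v → r ∙ u ≋ q ∙ v
    ∙-cong {r} {q} {u} {v} r≈q p t = begin
      coeff (r ∙ u) t  ≈⟨ coeff-∙ r u t ⟩
      r * coeff u t    ≈⟨ *-cong r≈q (p t) ⟩
      q * coeff v t    ≈⟨ coeff-∙ q v t ⟨
      coeff (q ∙ v) t  ∎

    ∙-zeroˡ : ∀ u → 0# ∙ u ≋ []
    ∙-zeroˡ u t = ≈-trans (coeff-∙ 0# u t) (zeroˡ _)

    ∙-distribʳ : ∀ u r q → (r + q) ∙ u ≋ r ∙ u ++ q ∙ u
    ∙-distribʳ u r q t = begin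
      coeff ((r + q) ∙ u) t              ≈⟨ coeff-∙ (r + q) u t ⟩
      (r + q) * coeff u t                ≈⟨ distribʳ _ r q ⟩
      r * coeff u t + q * coeff u t      ≈⟨ +-cong (coeff-∙ r u t) (coeff-∙ q u t) ⟨
      coeff (r ∙ u) t + coeff (q ∙ u) t  ≈⟨ coeff-++ (r ∙ u) (q ∙ u) t ⟨
      coeff (r ∙ u ++ q ∙ u) t           ∎

    ∙-identityˡ : ∀ u → 1# ∙ u ≋ u
    ∙-identityˡ u t = ≈-trans (coeff-∙ 1# u t) (*-identityˡ _)

    ∙-assoc : ∀ r q u → (r * q) ∙ u ≋ r ∙ (q ∙ u)
    ∙-assoc r q u t = begin
      coeff ((r * q) ∙ u) t  ≈⟨ coeff-∙ (r * q) u t ⟩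
      (r * q) * coeff u t    ≈⟨ *-assoc r q _ ⟩
      r * (q * coeff u t)    ≈⟨ *-congˡ (coeff-∙ q u t) ⟨
      r * coeff (q ∙ u) t    ≈⟨ coeff-∙ r (q ∙ u) t ⟨
      coeff (r ∙ (q ∙ u)) t  ∎

    ∙-distribˡ : ∀ r u v → r ∙ (u ++ v) ≋ r ∙ u ++ r ∙ v
    ∙-distribˡ r u v t = begin
      coeff (r ∙ (u ++ v)) t             ≈⟨ coeff-∙ r (u ++ v) t ⟩
      r * coeff (u ++ v) t               ≈⟨ *-congˡ (coeff-++ u v t) ⟩
      r * (coeff u t + coeff v t)        ≈⟨ distribˡ r _ _ ⟩
      r * coeff u t + r * coeff v t      ≈⟨ +-cong (coeff-∙ r u t) (coeff-∙ r v t) ⟨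
      coeff (r ∙ u) t + coeff (r ∙ v) t  ≈⟨ coeff-++ (r ∙ u) (r ∙ v) t ⟨
      coeff (r ∙ u ++ r ∙ v) t           ∎

  vectorSpace : VectorSpace K c ℓ₁
  vectorSpace = record
    { Carrierᴹ = Combination
    ; _≈ᴹ_     = _≋_
    ; _+ᴹ_     = _++_
    ; _*ₗ_     = _∙_
    ; _*ᵣ_     = λ u r → r ∙ u
    ; 0ᴹ       = []
    ; -ᴹ_      = neg
    ; isModule = IsModuleFromLeft.isModule {commutativeRing = fieldRing K} record
      { isLeftModule = record
        { isLeftSemimodule = record
          { +ᴹ-isCommutativeMonoid = record
            { isMonoid = record
              { isSemigroup = record
                { isMagma = record
                  { isEquivalence = record
                    { refl  = λ _ → ≈-refl
                    ; sym   = λ p t → ≈-sym (p t)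
                    ; trans = λ p q t → ≈-trans (p t) (q t)
                    }
                  ; ∙-cong = λ {u} {u′} {v} {v′} → ++-cong {u} {u′} {v} {v′}
                  }
                ; assoc = ++-assoc
                }
              ; identity = (λ _ _ → ≈-refl) , (λ u t → ++-comm u [] t)
              }
            ; comm = ++-comm
            }
          ; isPreleftSemimodule = record
            { *ₗ-cong      = λ {r} {q} {u} {v} → ∙-cong {r} {q} {u} {v}
            ; *ₗ-zeroˡ     = ∙-zeroˡ
            ; *ₗ-distribʳ  = ∙-distribʳ
            ; *ₗ-identityˡ = ∙-identityˡ
            ; *ₗ-assoc     = ∙-assoc
            ; *ₗ-zeroʳ     = λ _ _ → ≈-refl
            ; *ₗ-distribˡ  = ∙-distribˡ
            }
          }
        ; -ᴹ‿cong    = λ {u} {v} → neg-cong {u} {v}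
        ; -ᴹ‿inverse = neg-inverseˡ , neg-inverseʳ
        }
      }
    }

------------------------------------------------------------------------
-- γ-polydendriform algebras; Fin γ plays the role of [γ]

infixl 7 _⊓_
_⊓_ : Fin γ → Fin γ → Fin γ
_⊓_ {γ} = Min._⊓_ (Fin.≤-totalOrder γ)

module _ (K : HeytingField c ℓ₁ ℓ₂) (γ : ℕ) (V : VectorSpace K m ℓ) where

  open Module V

  record IsPolydendriform (_≺[_]_ _≻[_]_ : Carrierᴹ → Fin γ → Carrierᴹ → Carrierᴹ) :
                          Set (c ⊔ m ⊔ ℓ) where
    field
      ≺-linearˡ : ∀ a y → IsLinear K V V (λ x → x ≺[ a ] y)
      ≺-linearʳ : ∀ a x → IsLinear K V V (λ y → x ≺[ a ] y)
      ≻-linearˡ : ∀ a y → IsLinear K V V (λ x → x ≻[ a ] y)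
      ≻-linearʳ : ∀ a x → IsLinear K V V (λ y → x ≻[ a ] y)
      ≻-≺ : ∀ a a′ x y z →
        ((x ≻[ a′ ] y) ≺[ a ] z) ≈ᴹ (x ≻[ a′ ] (y ≺[ a ] z))
      ≺-≺ : ∀ a a′ x y z →
        ((x ≺[ a′ ] y) ≺[ a ] z) ≈ᴹ
        ((x ≺[ a ⊓ a′ ] (y ≺[ a ] z)) +ᴹ (x ≺[ a ⊓ a′ ] (y ≻[ a′ ] z)))
      ≻-≻ : ∀ a a′ x y z →
        (((x ≺[ a′ ] y) ≻[ a ⊓ a′ ] z) +ᴹ ((x ≻[ a ] y) ≻[ a ⊓ a′ ] z)) ≈ᴹ
        (x ≻[ a ] (y ≻[ a′ ] z))

record PolydendriformAlgebra (K : HeytingField c ℓ₁ ℓ₂) (γ : ℕ) m ℓ :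
                             Set (c ⊔ ℓ₁ ⊔ lsuc (m ⊔ ℓ)) where
  field
    vectorSpace : VectorSpace K m ℓ

  open Module vectorSpace public using (Carrierᴹ; _≈ᴹ_)

  field
    _≺[_]_ _≻[_]_    : Carrierᴹ → Fin γ → Carrierᴹ → Carrierᴹ
    isPolydendriform : IsPolydendriform K γ vectorSpace _≺[_]_ _≻[_]_

module _ {K : HeytingField c ℓ₁ ℓ₂} {γ : ℕ} where

  record Morphism (P : PolydendriformAlgebra K γ m ℓ)
                  (Q : PolydendriformAlgebra K γ m′ ℓ′) :
                  Set (c ⊔ m ⊔ m′ ⊔ ℓ ⊔ ℓ′) where
    private
      module P = PolydendriformAlgebra P
      module Q = PolydendriformAlgebra Q
    field
      ⟦_⟧      : P.Carrierᴹ → Q.Carrierᴹ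
      isLinear : IsLinear K P.vectorSpace Q.vectorSpace ⟦_⟧
      ≺-homo   : ∀ a x y → ⟦ x P.≺[ a ] y ⟧ Q.≈ᴹ (⟦ x ⟧ Q.≺[ a ] ⟦ y ⟧)
      ≻-homo   : ∀ a x y → ⟦ x P.≻[ a ] y ⟧ Q.≈ᴹ (⟦ x ⟧ Q.≻[ a ] ⟦ y ⟧)

  open Morphism using (⟦_⟧)

  _≗ᴹ_ : {P : PolydendriformAlgebra K γ m ℓ} {Q : PolydendriformAlgebra K γ m′ ℓ′} →
         Rel (Morphism P Q) (m ⊔ ℓ′)
  _≗ᴹ_ {Q = Q} φ ψ = ∀ x → ⟦ φ ⟧ x ≈ᴹ ⟦ ψ ⟧ x
    where open PolydendriformAlgebra Q using (_≈ᴹ_)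

-- The universal property ranges over algebras at all universe levels,
-- so this record lives in Setω.
record IsFreePolydendriformOnOneGenerator
         (K : HeytingField c ℓ₁ ℓ₂) (γ : ℕ) (V : VectorSpace K m ℓ)
         (_≺[_]_ _≻[_]_ : Module.Carrierᴹ V → Fin γ → Module.Carrierᴹ V → Module.Carrierᴹ V) :
         Setω where
  open Morphism using (⟦_⟧)

  field
    isPolydendriform : IsPolydendriform K γ V _≺[_]_ _≻[_]_

  algebra : PolydendriformAlgebra K γ m ℓ
  algebra = record { isPolydendriform = isPolydendriform }

  field
    generator : Module.Carrierᴹ V
    universal : ∀ {m′ ℓ′} (Q : PolydendriformAlgebra K γ m′ ℓ′)
                (let open PolydendriformAlgebra Q using (_≈ᴹ_)) →
                ∀ q → ∃! (_≗ᴹ_ {P = algebra} {Q}) (λ φ → ⟦ φ ⟧ generator ≈ᴹ q)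

------------------------------------------------------------------------
-- γ-edge valued binary trees

-- Whether a node is a leaf or an internal node. The label of an edge is
-- indexed by the kind of the node below it: edges to leaves carry ∞,
-- edges to internal nodes carry an element of [γ].
data Kind : Set where
  leaf internal : Kind

data Label (γ : ℕ) : Kind → Set where
  ∞   : Label γ leaf
  fin : Fin γ → Label γ internal

data TreeOrLeaf (γ : ℕ) : Kind → Set where
  ⊥ : TreeOrLeaf γ leaf
  B : ∀ {k l} → Label γ k → Label γ l →
      TreeOrLeaf γ k → TreeOrLeaf γ l → TreeOrLeaf γ internal

Tree : ℕ → Set
Tree γ = TreeOrLeaf γ internal

infixl 7 _↓_
_↓_ : ∀ {k} → Fin γ → Label γ k → Fin γ
a ↓ ∞     = a
a ↓ fin b = a ⊓ b

_≟ᴷ_ : DecidableEquality Kind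
leaf     ≟ᴷ leaf     = yes refl
leaf     ≟ᴷ internal = no λ ()
internal ≟ᴷ leaf     = no λ ()
internal ≟ᴷ internal = yes refl

_≟ᴸ_ : ∀ {k} → DecidableEquality (Label γ k)
∞     ≟ᴸ ∞     = yes refl
fin a ≟ᴸ fin b with a Fin.≟ b
... | yes refl = yes refl
... | no  a≢b  = no λ { refl → a≢b refl }

_≟ᵀ_ : ∀ {k} → DecidableEquality (TreeOrLeaf γ k)
⊥ ≟ᵀ ⊥ = yes refl
B {k} {l} x y s t ≟ᵀ B {k′} {l′} x′ y′ s′ t′ with k ≟ᴷ k′ | l ≟ᴷ l′
... | no k≢k′  | _        = no λ { refl → k≢k′ refl }
... | yes _    | no l≢l′  = no λ { refl → l≢l′ refl }
... | yes refl | yes refl with x ≟ᴸ x′ | y ≟ᴸ y′ | s ≟ᵀ s′ | t ≟ᵀ t′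
...   | yes refl | yes refl | yes refl | yes refl = yes refl
...   | no x≢x′  | _        | _        | _        = no λ { refl → x≢x′ refl }
...   | yes _    | no y≢y′  | _        | _        = no λ { refl → y≢y′ refl }
...   | yes _    | yes _    | no s≢s′  | _        = no λ { refl → s≢s′ refl }
...   | yes _    | yes _    | yes _    | no t≢t′  = no λ { refl → t≢t′ refl }

module TreeAlgebra (K : HeytingField c ℓ₁ ℓ₂) (γ : ℕ) where

  open FreeVectorSpace K (_≟ᵀ_ {γ} {internal}) public

  private
    variable
      k l n : Kind

  -- B is linear in either subtree.
  Bˡ : Label γ internal → Label γ l → Combination → TreeOrLeaf γ l → Combination
  Bˡ x y u t₂ = map (map₂ (λ t₁ → B x y t₁ t₂)) u

  Bʳ : Label γ k → Label γ internal → TreeOrLeaf γ k → Combination → Combination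
  Bʳ x y t₁ u = map (map₂ (λ t₂ → B x y t₁ t₂)) u

  -- The operations on single trees or leaves. The values on two leaves,
  -- and on two trees with index ∞, are junk: these cases are undefined
  -- mathematically and are never reached from two trees and an index in [γ].
  mutual
    _≺ᵗ[_]_ : TreeOrLeaf γ k → Label γ n → TreeOrLeaf γ l → Combination
    ⊥              ≺ᵗ[ a ]     s            = []
    s@(B _ _ _ _)  ≺ᵗ[ a ]     ⊥            = basis s
    B x y t₁ t₂    ≺ᵗ[ fin a ] s@(B _ _ _ _) =
      Bʳ x (fin (a ↓ y)) t₁ (t₂ ≺ᵗ[ fin a ] s) ++ Bʳ x (fin (a ↓ y)) t₁ (t₂ ≻ᵗ[ y ] s)
    B _ _ _ _      ≺ᵗ[ ∞ ]     B _ _ _ _    = []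

    _≻ᵗ[_]_ : TreeOrLeaf γ k → Label γ n → TreeOrLeaf γ l → Combination
    s              ≻ᵗ[ a ]     ⊥            = []
    ⊥              ≻ᵗ[ a ]     s@(B _ _ _ _) = basis s
    s@(B _ _ _ _)  ≻ᵗ[ fin a ] B x y t₁ t₂  =
      Bˡ (fin (a ↓ x)) y (s ≻ᵗ[ fin a ] t₁) t₂ ++ Bˡ (fin (a ↓ x)) y (s ≺ᵗ[ x ] t₁) t₂
    B _ _ _ _      ≻ᵗ[ ∞ ]     B _ _ _ _    = []

  _≺[_]_ _≻[_]_ : Combination → Fin γ → Combination → Combination
  u ≺[ a ] v = bilinear (λ s t → s ≺ᵗ[ fin a ] t) u v
  u ≻[ a ] v = bilinear (λ s t → s ≻ᵗ[ fin a ] t) u v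

{-# OPTIONS --safe #-}
-- On trees, expanding the root of the middle operand proves the first axiom.
-- Expanding the root of the left (right) operand reduces the second (third)
-- axiom to the associativity of the sum of ≺ and ≻ on a subtree, which is the
-- sum of the three axioms there. Equalities of combinations are stated after
-- summing an arbitrary h : Tree → W, so that products of combinations become
-- iterated sums over trees.
--
-- For freeness, B x y t₁ t₂ = t₁ ≻ₓ (● ≺_y t₂) with ● the tree with one internal
-- node, which forces the value of a morphism on every tree. Conversely, the
-- axioms of the target say that these values are compatible with the recursion
-- defining the products.

module Submission where

open import Defs
open import Algebra.Apartness.Bundles using (HeytingField)
open import Algebra.Bundles using (CommutativeMonoid; CommutativeRing)
import Algebra.Construct.NaturalChoice.Min as Min
open import Algebra.Module.Bundles using (Module)
import Algebra.Module.Morphism.Structures as ModuleMorphism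
import Algebra.Properties.CommutativeSemigroup as CommutativeSemigroupProperties
import Algebra.Properties.Group as GroupProperties
import Algebra.Properties.Ring as RingProperties
open import Data.Bool.Base using (true; false; if_then_else_)
open import Data.Fin.Base using (Fin)
import Data.Fin.Properties as Fin
open import Data.List.Base using ([]; _∷_; _++_; map; concatMap; length)
open import Data.Nat.Base using (ℕ; suc; _≤_; z≤n; s≤s)
import Data.Nat.Properties as ℕ
open import Data.Product.Base using (_,_; map₂)
open import Function.Base using (_∘_)
open import Level using (Level)
open import Relation.Binary.Definitions using (DecidableEquality)
open import Relation.Binary.PropositionalEquality.Core as ≡ using (_≡_; refl)
import Relation.Binary.Reasoning.Setoid as SetoidReasoning
open import Relation.Nullary using (yes; no; does)
open import Relation.Nullary.Negation using (contradiction)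

private
  variable
    c ℓ₁ ℓ₂ m m′ ℓ ℓ′ : Level

-- Linear maps

module _ (K : HeytingField c ℓ₁ ℓ₂) (V : VectorSpace K m ℓ) (W : VectorSpace K m′ ℓ′) where

  open CommutativeRing (fieldRing K) using (0#)
  private
    module V = Module V
    module W = Module W
  open SetoidReasoning W.≈ᴹ-setoid
  open GroupProperties W.+ᴹ-group using (inverseˡ-unique)

  -- Zero is `0# *ₗ 0ᴹ`, so scalars already force `F` to preserve it; then `F (- x)` is an additive
  -- inverse of `F x`, and such inverses are unique. The right action coincides with the left one on
  -- both sides.
  mkLinear : {F : V.Carrierᴹ → W.Carrierᴹ} →
             (∀ {x y} → x V.≈ᴹ y → F x W.≈ᴹ F y) →
             (∀ x y → F (x V.+ᴹ y) W.≈ᴹ F x W.+ᴹ F y) →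
             (∀ r x → F (r V.*ₗ x) W.≈ᴹ r W.*ₗ F x) →
             IsLinear K V W F
  mkLinear {F} cong +-homo *-homo = record
    { isBimoduleHomomorphism = record
      { +ᴹ-isGroupHomomorphism = record
        { isMonoidHomomorphism = record
          { isMagmaHomomorphism = record
            { isRelHomomorphism = record { cong = cong }
            ; homo              = +-homo
            }
          ; ε-homo = 0-homo
          }
        ; ⁻¹-homo = λ x → inverseˡ-unique (F (V.-ᴹ x)) (F x) (begin
            F (V.-ᴹ x) W.+ᴹ F x  ≈⟨ +-homo (V.-ᴹ x) x ⟨
            F (V.-ᴹ x V.+ᴹ x)    ≈⟨ cong (V.-ᴹ‿inverseˡ x) ⟩
            F V.0ᴹ               ≈⟨ 0-homo ⟩
            W.0ᴹ                 ∎)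
        }
      ; *ₗ-homo = *-homo
      ; *ᵣ-homo = λ r x → begin
          F (x V.*ᵣ r)  ≈⟨ cong (V.*ₗ-*ᵣ-coincident r x) ⟨
          F (r V.*ₗ x)  ≈⟨ *-homo r x ⟩
          r W.*ₗ F x    ≈⟨ W.*ₗ-*ᵣ-coincident r (F x) ⟩
          F x W.*ᵣ r    ∎
      }
    }
    where
    0-homo : F V.0ᴹ W.≈ᴹ W.0ᴹ
    0-homo = begin
      F V.0ᴹ            ≈⟨ cong (V.*ₗ-zeroˡ V.0ᴹ) ⟨
      F (0# V.*ₗ V.0ᴹ)  ≈⟨ *-homo 0# V.0ᴹ ⟩
      0# W.*ₗ F V.0ᴹ    ≈⟨ W.*ₗ-zeroˡ (F V.0ᴹ) ⟩
      W.0ᴹ              ∎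

module Linear (K : HeytingField c ℓ₁ ℓ₂) (V : VectorSpace K m ℓ) (W : VectorSpace K m′ ℓ′)
              {F : Module.Carrierᴹ V → Module.Carrierᴹ W} (F-linear : IsLinear K V W F) where
  open ModuleMorphism.ModuleMorphisms.IsModuleHomomorphism F-linear public
    using (⟦⟧-cong; +ᴹ-homo; *ₗ-homo; 0ᴹ-homo)

-- Linear extension of maps defined on a basis

module Removal (K : HeytingField c ℓ₁ ℓ₂) {A : Set} (_≟_ : DecidableEquality A) where

  private module K = CommutativeRing (fieldRing K)
  open FreeVectorSpace K _≟_

  remove : A → Combination → Combination
  remove t []            = []
  remove t ((r , s) ∷ u) = if does (s ≟ t) then remove t u else (r , s) ∷ remove t u

  length-remove : ∀ t u → length (remove t u) ≤ length u
  length-remove t []            = z≤n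
  length-remove t ((r , s) ∷ u) with does (s ≟ t)
  ... | true  = ℕ.m≤n⇒m≤1+n (length-remove t u)
  ... | false = s≤s (length-remove t u)

  coeff-remove-≡ : ∀ t u → coeff (remove t u) t K.≈ K.0#
  coeff-remove-≡ t []            = K.refl
  coeff-remove-≡ t ((r , s) ∷ u) with does (s ≟ t) in eq
  ... | true  = coeff-remove-≡ t u
  ... | false rewrite eq = K.trans (K.+-identityˡ _) (coeff-remove-≡ t u)

  coeff-remove-≢ : ∀ {t t′} u → t ≡.≢ t′ → coeff (remove t u) t′ K.≈ coeff u t′
  coeff-remove-≢ []            t≢t′ = K.refl
  coeff-remove-≢ {t} {t′} ((r , s) ∷ u) t≢t′ with s ≟ t
  ... | no  _    = K.+-congˡ (coeff-remove-≢ u t≢t′)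
  ... | yes refl with s ≟ t′
  ...   | yes s≡t′ = contradiction s≡t′ t≢t′
  ...   | no  _    = K.trans (coeff-remove-≢ u t≢t′) (K.sym (K.+-identityˡ _))

module Sum (K : HeytingField c ℓ₁ ℓ₂) {A : Set} (_≟_ : DecidableEquality A)
           (W : VectorSpace K m ℓ) where

  private module K = CommutativeRing (fieldRing K)
  open FreeVectorSpace K _≟_
  open Removal K _≟_
  open Module W
  open SetoidReasoning ≈ᴹ-setoid
  open CommutativeSemigroupProperties
    (CommutativeMonoid.commutativeSemigroup +ᴹ-commutativeMonoid) using (interchange; x∙yz≈y∙xz)
  open RingProperties K.ring using (-1*x≈-x)

  ∑ : Combination → (A → Carrierᴹ) → Carrierᴹ
  ∑ []            h = 0ᴹ
  ∑ ((r , t) ∷ u) h = r *ₗ h t +ᴹ ∑ u h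

  infix 5 ∑
  syntax ∑ u (λ t → h) = ∑[ t ← u ] h

  private
    variable
      h g : A → Carrierᴹ

  ∑-cong : ∀ u → (∀ t → h t ≈ᴹ g t) → ∑ u h ≈ᴹ ∑ u g
  ∑-cong []            h≈g = ≈ᴹ-refl
  ∑-cong ((r , t) ∷ u) h≈g = +ᴹ-cong (*ₗ-congˡ (h≈g t)) (∑-cong u h≈g)

  ∑-++ : ∀ u v → ∑ (u ++ v) h ≈ᴹ ∑ u h +ᴹ ∑ v h
  ∑-++ []            v = ≈ᴹ-sym (+ᴹ-identityˡ _)
  ∑-++ ((r , t) ∷ u) v = ≈ᴹ-trans (+ᴹ-congˡ (∑-++ u v)) (≈ᴹ-sym (+ᴹ-assoc _ _ _))

  ∑-∙ : ∀ r u → ∑ (r ∙ u) h ≈ᴹ r *ₗ ∑ u h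
  ∑-∙ r []            = ≈ᴹ-sym (*ₗ-zeroʳ r)
  ∑-∙ r ((q , t) ∷ u) =
    ≈ᴹ-trans (+ᴹ-cong (*ₗ-assoc r q _) (∑-∙ r u)) (≈ᴹ-sym (*ₗ-distribˡ r _ _))

  ∑-basis : ∀ t → ∑ (basis t) h ≈ᴹ h t
  ∑-basis t = ≈ᴹ-trans (+ᴹ-identityʳ _) (*ₗ-identityˡ _)

  ∑-map₂ : ∀ (f : A → A) u → ∑ (map (map₂ f) u) h ≈ᴹ ∑ u (h ∘ f)
  ∑-map₂ f []            = ≈ᴹ-refl
  ∑-map₂ f ((r , t) ∷ u) = +ᴹ-congˡ (∑-map₂ f u)

  ∑-0 : ∀ u → ∑[ _ ← u ] 0ᴹ ≈ᴹ 0ᴹ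
  ∑-0 []            = ≈ᴹ-refl
  ∑-0 ((r , t) ∷ u) = ≈ᴹ-trans (+ᴹ-cong (*ₗ-zeroʳ r) (∑-0 u)) (+ᴹ-identityˡ _)

  ∑-+ : ∀ u → ∑[ t ← u ] (h t +ᴹ g t) ≈ᴹ ∑ u h +ᴹ ∑ u g
  ∑-+ []            = ≈ᴹ-sym (+ᴹ-identityˡ _)
  ∑-+ ((r , t) ∷ u) =
    ≈ᴹ-trans (+ᴹ-cong (*ₗ-distribˡ r _ _) (∑-+ u)) (interchange _ _ _ _)

  ∑-*ₗ : ∀ r u → ∑[ t ← u ] (r *ₗ h t) ≈ᴹ r *ₗ ∑ u h
  ∑-*ₗ r []            = ≈ᴹ-sym (*ₗ-zeroʳ r)
  ∑-*ₗ r ((q , t) ∷ u) =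
    ≈ᴹ-trans (+ᴹ-cong (*ₗ-comm q r _) (∑-*ₗ r u)) (≈ᴹ-sym (*ₗ-distribˡ r _ _))

  ∑-swap : ∀ u v {f : A → A → Carrierᴹ} →
           ∑[ s ← u ] ∑[ t ← v ] f s t ≈ᴹ ∑[ t ← v ] ∑[ s ← u ] f s t
  ∑-swap []            v = ≈ᴹ-sym (∑-0 v)
  ∑-swap ((r , s) ∷ u) v {f} = begin
    r *ₗ ∑ v (f s) +ᴹ (∑[ s ← u ] ∑[ t ← v ] f s t)
      ≈⟨ +ᴹ-cong (≈ᴹ-sym (∑-*ₗ r v)) (∑-swap u v) ⟩
    (∑[ t ← v ] r *ₗ f s t) +ᴹ (∑[ t ← v ] ∑[ s ← u ] f s t)
      ≈⟨ ∑-+ v ⟨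
    ∑[ t ← v ] (r *ₗ f s t +ᴹ (∑[ s ← u ] f s t))
      ∎

  ∑-bilinear : ∀ f u v → ∑ (bilinear f u v) h ≈ᴹ ∑[ s ← u ] ∑[ t ← v ] ∑ (f s t) h
  ∑-bilinear         f []            v = ≈ᴹ-refl
  ∑-bilinear {h = h} f ((r , s) ∷ u) v =
    ≈ᴹ-trans (∑-++ (row v) (bilinear f u v)) (+ᴹ-cong (∑-row v) (∑-bilinear f u v))
    where
    row : Combination → Combination
    row = concatMap (λ (q , t) → (r K.* q) ∙ f s t)

    ∑-row : ∀ v → ∑ (row v) h ≈ᴹ r *ₗ (∑[ t ← v ] ∑ (f s t) h)
    ∑-row []            = ≈ᴹ-sym (*ₗ-zeroʳ r)
    ∑-row ((q , t) ∷ v) = begin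
      ∑ ((r K.* q) ∙ f s t ++ row v) h
        ≈⟨ ∑-++ ((r K.* q) ∙ f s t) (row v) ⟩
      ∑ ((r K.* q) ∙ f s t) h +ᴹ ∑ (row v) h
        ≈⟨ +ᴹ-cong (∑-∙ (r K.* q) (f s t)) (∑-row v) ⟩
      (r K.* q) *ₗ ∑ (f s t) h +ᴹ r *ₗ (∑[ t ← v ] ∑ (f s t) h)
        ≈⟨ +ᴹ-congʳ (*ₗ-assoc r q _) ⟩
      r *ₗ (q *ₗ ∑ (f s t) h) +ᴹ r *ₗ (∑[ t ← v ] ∑ (f s t) h)
        ≈⟨ *ₗ-distribˡ r _ _ ⟨
      r *ₗ (q *ₗ ∑ (f s t) h +ᴹ (∑[ t ← v ] ∑ (f s t) h))
        ∎

  -- The sum over `g x y` is moved innermost, so that both bracketings of a triple product have the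
  -- same three outer sums and an axiom can be checked on single trees.
  ∑-bilinearˡ : ∀ f g u v w → ∑ (bilinear f (bilinear g u v) w) h ≈ᴹ
                ∑[ x ← u ] ∑[ y ← v ] ∑[ z ← w ] ∑[ s ← g x y ] ∑ (f s z) h
  ∑-bilinearˡ {h = h} f g u v w = begin
    ∑ (bilinear f (bilinear g u v) w) h
      ≈⟨ ∑-bilinear f (bilinear g u v) w ⟩
    ∑[ s ← bilinear g u v ] ∑[ z ← w ] ∑ (f s z) h
      ≈⟨ ∑-bilinear g u v ⟩
    ∑[ x ← u ] ∑[ y ← v ] ∑[ s ← g x y ] ∑[ z ← w ] ∑ (f s z) h
      ≈⟨ ∑-cong u (λ x → ∑-cong v (λ y → ∑-swap (g x y) w)) ⟩
    ∑[ x ← u ] ∑[ y ← v ] ∑[ z ← w ] ∑[ s ← g x y ] ∑ (f s z) h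
      ∎

  ∑-bilinearʳ : ∀ f g u v w → ∑ (bilinear f u (bilinear g v w)) h ≈ᴹ
                ∑[ x ← u ] ∑[ y ← v ] ∑[ z ← w ] ∑[ s ← g y z ] ∑ (f x s) h
  ∑-bilinearʳ f g u v w =
    ≈ᴹ-trans (∑-bilinear f u (bilinear g v w)) (∑-cong u (λ x → ∑-bilinear g v w))

  ∑³-+ : ∀ u v w {f g : A → A → A → Carrierᴹ} →
         (∑[ x ← u ] ∑[ y ← v ] ∑[ z ← w ] f x y z) +ᴹ
         (∑[ x ← u ] ∑[ y ← v ] ∑[ z ← w ] g x y z) ≈ᴹ
         ∑[ x ← u ] ∑[ y ← v ] ∑[ z ← w ] (f x y z +ᴹ g x y z)
  ∑³-+ u v w = ≈ᴹ-trans (≈ᴹ-sym (∑-+ u)) (∑-cong u λ x →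
               ≈ᴹ-trans (≈ᴹ-sym (∑-+ v)) (∑-cong v λ y →
               ≈ᴹ-sym (∑-+ w)))

  ∑-remove : ∀ t u → ∑ u h ≈ᴹ coeff u t *ₗ h t +ᴹ ∑ (remove t u) h
  ∑-remove t [] = ≈ᴹ-sym (≈ᴹ-trans (+ᴹ-identityʳ _) (*ₗ-zeroˡ _))
  ∑-remove {h = h} t ((r , s) ∷ u) with s ≟ t
  ... | yes refl = begin
    r *ₗ h t +ᴹ ∑ u h
      ≈⟨ +ᴹ-congˡ (∑-remove t u) ⟩
    r *ₗ h t +ᴹ (coeff u t *ₗ h t +ᴹ ∑ (remove t u) h)
      ≈⟨ +ᴹ-assoc _ _ _ ⟨
    (r *ₗ h t +ᴹ coeff u t *ₗ h t) +ᴹ ∑ (remove t u) h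
      ≈⟨ +ᴹ-congʳ (*ₗ-distribʳ _ _ _) ⟨
    (r K.+ coeff u t) *ₗ h t +ᴹ ∑ (remove t u) h
      ∎
  ... | no _ = begin
    r *ₗ h s +ᴹ ∑ u h
      ≈⟨ +ᴹ-congˡ (∑-remove t u) ⟩
    r *ₗ h s +ᴹ (coeff u t *ₗ h t +ᴹ ∑ (remove t u) h)
      ≈⟨ x∙yz≈y∙xz _ _ _ ⟩
    coeff u t *ₗ h t +ᴹ (r *ₗ h s +ᴹ ∑ (remove t u) h)
      ≈⟨ +ᴹ-congʳ (*ₗ-congʳ (K.+-identityˡ _)) ⟨
    (K.0# K.+ coeff u t) *ₗ h t +ᴹ (r *ₗ h s +ᴹ ∑ (remove t u) h)
      ∎

  -- Entries of u may cancel, so the induction removes all entries at one basis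
  -- element at once and proceeds on the length.
  ∑-≋[] : ∀ n u → length u ≤ n → u ≋ [] → ∑ u h ≈ᴹ 0ᴹ
  ∑-≋[] n       []                _         u≋[] = ≈ᴹ-refl
  ∑-≋[] {h = h} (suc n) u@((r , t) ∷ u′) (s≤s ≤n) u≋[] = begin
    ∑ u h                                     ≈⟨ ∑-remove t u ⟩
    coeff u t *ₗ h t +ᴹ ∑ (remove t u) h      ≈⟨ +ᴹ-cong (*ₗ-congʳ (u≋[] t)) remaining ⟩
    K.0# *ₗ h t +ᴹ 0ᴹ                         ≈⟨ +ᴹ-identityʳ _ ⟩
    K.0# *ₗ h t                               ≈⟨ *ₗ-zeroˡ _ ⟩
    0ᴹ                                        ∎
    where
    shorter : length (remove t u) ≤ n
    -- The head entry of `u` sits at `t` itself, so it is removed and the length drops.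
    shorter with t ≟ t
    ... | yes _  = ℕ.≤-trans (length-remove t u′) ≤n
    ... | no t≢t = contradiction refl t≢t

    remove≋[] : remove t u ≋ []
    remove≋[] t′ with t ≟ t′
    ... | yes refl = coeff-remove-≡ t u
    ... | no t≢t′  = K.trans (coeff-remove-≢ u t≢t′) (u≋[] t′)

    remaining : ∑ (remove t u) h ≈ᴹ 0ᴹ
    remaining = ∑-≋[] n (remove t u) shorter remove≋[]

  -- `≋` compares coefficients whereas `∑` runs through entries, so this is the well-definedness of
  -- the linear extension of `h`. It reduces to a combination with zero coefficients, namely the
  -- difference; writing that as `u ++ -1# ∙ v` makes `∑-∙` applicable.
  ∑-≋ : ∀ {u v} → u ≋ v → ∑ u h ≈ᴹ ∑ v h
  ∑-≋ {h = h} {u} {v} u≋v = begin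
    ∑ u h                              ≈⟨ +ᴹ-identityʳ _ ⟨
    ∑ u h +ᴹ 0ᴹ                        ≈⟨ +ᴹ-congˡ cancel ⟨
    ∑ u h +ᴹ (-1# *ₗ ∑ v h +ᴹ ∑ v h)   ≈⟨ +ᴹ-assoc _ _ _ ⟨
    (∑ u h +ᴹ -1# *ₗ ∑ v h) +ᴹ ∑ v h   ≈⟨ +ᴹ-congʳ (+ᴹ-congˡ (∑-∙ -1# v)) ⟨
    (∑ u h +ᴹ ∑ (-1# ∙ v) h) +ᴹ ∑ v h  ≈⟨ +ᴹ-congʳ (∑-++ u (-1# ∙ v)) ⟨
    ∑ (u ++ -1# ∙ v) h +ᴹ ∑ v h        ≈⟨ +ᴹ-congʳ (∑-≋[] _ (u ++ -1# ∙ v) ℕ.≤-refl difference) ⟩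
    0ᴹ +ᴹ ∑ v h                        ≈⟨ +ᴹ-identityˡ _ ⟩
    ∑ v h                              ∎
    where
    -1# : K.Carrier
    -1# = K.- K.1#

    cancel : ∀ {w} → -1# *ₗ w +ᴹ w ≈ᴹ 0ᴹ
    cancel {w} = begin
      -1# *ₗ w +ᴹ w          ≈⟨ +ᴹ-congˡ (*ₗ-identityˡ w) ⟨
      -1# *ₗ w +ᴹ K.1# *ₗ w  ≈⟨ *ₗ-distribʳ w _ _ ⟨
      (-1# K.+ K.1#) *ₗ w    ≈⟨ *ₗ-congʳ (K.-‿inverseˡ K.1#) ⟩
      K.0# *ₗ w              ≈⟨ *ₗ-zeroˡ w ⟩
      0ᴹ                     ∎

    difference : u ++ -1# ∙ v ≋ []
    difference t = K.trans (coeff-++ u (-1# ∙ v) t)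
      (K.trans (K.+-cong (u≋v t) (coeff-∙ -1# v t))
      (K.trans (K.+-congˡ (-1*x≈-x _)) (K.-‿inverseʳ _)))

  ∑-linear : IsLinear K vectorSpace W (λ u → ∑ u h)
  ∑-linear = mkLinear K vectorSpace W (λ {u} {v} → ∑-≋ {u = u} {v}) ∑-++ ∑-∙

module _ (K : HeytingField c ℓ₁ ℓ₂) {A : Set} (_≟_ : DecidableEquality A) where

  open FreeVectorSpace K _≟_

  module _ {V : VectorSpace K m ℓ} {W : VectorSpace K m′ ℓ′}
           {F : Module.Carrierᴹ V → Module.Carrierᴹ W} (F-linear : IsLinear K V W F) where

    open Module W
    open Linear K V W F-linear
    open Sum K _≟_ V using () renaming (∑ to ∑ⱽ)
    open Sum K _≟_ W using (∑)

    linear-∑ : ∀ u {h} → F (∑ⱽ u h) ≈ᴹ ∑ u (F ∘ h)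
    linear-∑ []            = 0ᴹ-homo
    linear-∑ ((r , t) ∷ u) =
      ≈ᴹ-trans (+ᴹ-homo _ _) (+ᴹ-cong (*ₗ-homo r _) (linear-∑ u))

  open Sum K _≟_ vectorSpace using (∑)
  open CommutativeRing (fieldRing K) using (_≈_; _*_; 1#; 0#; +-cong; *-identityʳ)
    renaming (refl to ≈-refl)

  -- Each entry `r` returns as `r * 1#`, so only the coefficients agree. This is the way back from
  -- identities between sums to identities between combinations.
  basis-expansion : ∀ u → ∑ u basis ≋ u
  basis-expansion []            t = ≈-refl
  basis-expansion ((r , s) ∷ u) t = +-cong (term (does (s ≟ t))) (basis-expansion u t)
    where
    term : ∀ b → (if b then r * 1# else 0#) ≈ (if b then r else 0#)
    term true  = *-identityʳ r
    term false = ≈-refl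

-- Two successive products relabel the same edge twice, while the other bracketing relabels it once
-- with a minimum. Associativity and commutativity of the minimum identify the resulting labels.
⊓-↓ : ∀ {γ k} (a b : Fin γ) (x : Label γ k) → b ⊓ (a ↓ x) ≡ (a ⊓ b) ↓ x
⊓-↓ {γ} a b ∞       = Min.⊓-comm (Fin.≤-totalOrder γ) b a
⊓-↓ {γ} a b (fin c) = ≡.trans (≡.sym (Min.⊓-assoc (Fin.≤-totalOrder γ) b a c))
                              (≡.cong (_⊓ c) (Min.⊓-comm (Fin.≤-totalOrder γ) b a))

-- Products of trees

module Products (K : HeytingField c ℓ₁ ℓ₂) (γ : ℕ) (W : VectorSpace K m ℓ) where

  open TreeAlgebra K γ
  open Sum K (_≟ᵀ_ {γ} {internal}) W
  open Module W
  open SetoidReasoning ≈ᴹ-setoid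

  private
    variable
      k l n : Kind
      h : Tree γ → Carrierᴹ

  infix 6 _⟪_∣_⟫_
  -- The new subtree in both recursive clauses: one index is that of the operation, the other is the
  -- old label of the edge above the subtree being multiplied. With a single index and no labels it
  -- would be the associative product of a dendriform algebra.
  _⟪_∣_⟫_ : TreeOrLeaf γ k → Label γ l → Label γ n → TreeOrLeaf γ l → Combination
  s ⟪ a ∣ b ⟫ t = s ≺ᵗ[ a ] t ++ s ≻ᵗ[ b ] t

  ∑-⊥≻ : ∀ {a : Label γ n} (t : Tree γ) → ∑ (⊥ ≻ᵗ[ a ] t) h ≈ᴹ h t
  ∑-⊥≻ {h = h} t@(B _ _ _ _) = ∑-basis {h = h} t

  ∑-≺⊥ : ∀ {a : Label γ n} (t : Tree γ) → ∑ (t ≺ᵗ[ a ] ⊥) h ≈ᴹ h t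
  ∑-≺⊥ {h = h} t@(B _ _ _ _) = ∑-basis {h = h} t

  ∑-≺ : ∀ {a} {x : Label γ k} {y : Label γ l} {t₁} t₂ (s : Tree γ) →
        ∑ (B x y t₁ t₂ ≺ᵗ[ fin a ] s) h ≈ᴹ
        ∑[ t ← t₂ ⟪ fin a ∣ y ⟫ s ] h (B x (fin (a ↓ y)) t₁ t)
  ∑-≺ {h = h} {a} {x} {y} {t₁} t₂ s@(B _ _ _ _) = begin
    ∑ (Bʳ x z t₁ u ++ Bʳ x z t₁ v) h              ≈⟨ ∑-++ (Bʳ x z t₁ u) _ ⟩
    ∑ (Bʳ x z t₁ u) h +ᴹ ∑ (Bʳ x z t₁ v) h        ≈⟨ +ᴹ-cong (∑-map₂ _ u) (∑-map₂ _ v) ⟩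
    ∑ u (h ∘ B x z t₁) +ᴹ ∑ v (h ∘ B x z t₁)      ≈⟨ ∑-++ u v ⟨
    ∑ (u ++ v) (h ∘ B x z t₁)                     ∎
    where
    z = fin (a ↓ y)
    u = t₂ ≺ᵗ[ fin a ] s
    v = t₂ ≻ᵗ[ y ] s

  ∑-≻ : ∀ {a} {x : Label γ k} {y : Label γ l} (s : Tree γ) t₁ {t₂} →
        ∑ (s ≻ᵗ[ fin a ] B x y t₁ t₂) h ≈ᴹ
        ∑[ t ← s ⟪ x ∣ fin a ⟫ t₁ ] h (B (fin (a ↓ x)) y t t₂)
  ∑-≻ {h = h} {a} {x} {y} s@(B _ _ _ _) t₁ {t₂} = begin
    ∑ (Bˡ z y v t₂ ++ Bˡ z y u t₂) h          ≈⟨ ∑-++ (Bˡ z y v t₂) _ ⟩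
    ∑ (Bˡ z y v t₂) h +ᴹ ∑ (Bˡ z y u t₂) h    ≈⟨ +ᴹ-cong (∑-map₂ _ v) (∑-map₂ _ u) ⟩
    ∑ v h′ +ᴹ ∑ u h′                          ≈⟨ +ᴹ-comm _ _ ⟩
    ∑ u h′ +ᴹ ∑ v h′                          ≈⟨ ∑-++ u v ⟨
    ∑ (u ++ v) h′                             ∎
    where
    z  = fin (a ↓ x)
    u  = s ≺ᵗ[ x ] t₁
    v  = s ≻ᵗ[ fin a ] t₁
    h′ = λ t → h (B z y t t₂)

  -- Multiplying `y` from the left affects only its left subtree and left label, multiplying from
  -- the right only the right ones. Both sides are therefore the same double sum in two orders. The
  -- outer factors may be leaves, with index `∞`, since `⟪⟫-assoc` is applied to subtrees.
  ≻ᵗ-≺ᵗ : ∀ (x : TreeOrLeaf γ k) (a : Label γ k) (y : Tree γ)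
            (b : Label γ l) (z : TreeOrLeaf γ l) →
          ∑[ r ← x ≻ᵗ[ a ] y ] ∑ (r ≺ᵗ[ b ] z) h ≈ᴹ ∑[ r ← y ≺ᵗ[ b ] z ] ∑ (x ≻ᵗ[ a ] r) h
  ≻ᵗ-≺ᵗ ⊥ a y b z =
    ≈ᴹ-trans (∑-⊥≻ y) (≈ᴹ-sym (∑-cong (y ≺ᵗ[ b ] z) ∑-⊥≻))
  ≻ᵗ-≺ᵗ x@(B _ _ _ _) a y b ⊥ =
    ≈ᴹ-trans (∑-cong (x ≻ᵗ[ a ] y) ∑-≺⊥) (≈ᴹ-sym (∑-≺⊥ y))
  ≻ᵗ-≺ᵗ {h = h} x@(B _ _ _ _) (fin a) (B p q y₁ y₂) (fin b) z@(B _ _ _ _) = begin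
    ∑[ r ← x ≻ᵗ[ fin a ] B p q y₁ y₂ ] ∑ (r ≺ᵗ[ fin b ] z) h
      ≈⟨ ∑-≻ x y₁ ⟩
    ∑[ s ← left ] ∑ (B (fin (a ↓ p)) q s y₂ ≺ᵗ[ fin b ] z) h
      ≈⟨ ∑-cong left (λ _ → ∑-≺ y₂ z) ⟩
    ∑[ s ← left ] ∑[ t ← right ] h (B (fin (a ↓ p)) (fin (b ↓ q)) s t)
      ≈⟨ ∑-swap left right ⟩
    ∑[ t ← right ] ∑[ s ← left ] h (B (fin (a ↓ p)) (fin (b ↓ q)) s t)
      ≈⟨ ∑-cong right (λ _ → ∑-≻ x y₁) ⟨
    ∑[ t ← right ] ∑ (x ≻ᵗ[ fin a ] B p (fin (b ↓ q)) y₁ t) h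
      ≈⟨ ∑-≺ y₂ z ⟨
    ∑[ r ← B p q y₁ y₂ ≺ᵗ[ fin b ] z ] ∑ (x ≻ᵗ[ fin a ] r) h
      ∎
    where
    left  = x ⟪ p ∣ fin a ⟫ y₁
    right = y₂ ⟪ fin b ∣ q ⟫ z

  mutual

    -- Both sides vanish if `x` is a leaf. Otherwise only the right subtree of `x` changes, where
    -- the claim is `⟪⟫-assoc`, and `⊓-↓` matches the labels of the edge above it.
    ≺ᵗ-≺ᵗ : ∀ (x : TreeOrLeaf γ k) a (y : Tree γ) (b : Label γ l) (z : TreeOrLeaf γ l) →
            ∑[ r ← x ≺ᵗ[ fin a ] y ] ∑ (r ≺ᵗ[ b ] z) h ≈ᴹ
            ∑[ r ← y ⟪ b ∣ fin a ⟫ z ] ∑ (x ≺ᵗ[ fin (a ↓ b) ] r) h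
    ≺ᵗ-≺ᵗ ⊥ a y b z = ≈ᴹ-sym (∑-0 (y ⟪ b ∣ fin a ⟫ z))
    -- Exposing the root of `y` lets `y ⟪ ∞ ∣ fin a ⟫ ⊥` reduce to `basis y`.
    ≺ᵗ-≺ᵗ {h = h} x@(B _ _ _ _) a y@(B _ _ _ _) ∞ ⊥ =
      ≈ᴹ-trans (∑-cong (x ≺ᵗ[ fin a ] y) ∑-≺⊥)
               (≈ᴹ-sym (∑-basis {h = λ r → ∑ (x ≺ᵗ[ fin a ] r) h} y))
    ≺ᵗ-≺ᵗ {h = h} (B p q x₁ x₂) a y (fin b) z@(B _ _ _ _) = begin
      ∑[ r ← B p q x₁ x₂ ≺ᵗ[ fin a ] y ] ∑ (r ≺ᵗ[ fin b ] z) h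
        ≈⟨ ∑-≺ x₂ y ⟩
      ∑[ t ← x₂ ⟪ fin a ∣ q ⟫ y ] ∑ (B p (fin (a ↓ q)) x₁ t ≺ᵗ[ fin b ] z) h
        ≈⟨ ∑-cong (x₂ ⟪ fin a ∣ q ⟫ y) (λ t → ∑-≺ t z) ⟩
      ∑[ t ← x₂ ⟪ fin a ∣ q ⟫ y ] ∑[ r ← t ⟪ fin b ∣ fin (a ↓ q) ⟫ z ]
        h (B p (fin (b ⊓ (a ↓ q))) x₁ r)
        ≈⟨ ⟪⟫-assoc x₂ q a y (fin b) z ⟩
      ∑[ r ← y ⟪ fin b ∣ fin a ⟫ z ] ∑[ t ← x₂ ⟪ fin (a ⊓ b) ∣ q ⟫ r ]
        h (B p (fin (b ⊓ (a ↓ q))) x₁ t)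
        ≡⟨ ≡.cong (λ e → ∑[ r ← y ⟪ fin b ∣ fin a ⟫ z ] ∑[ t ← x₂ ⟪ fin (a ⊓ b) ∣ q ⟫ r ]
                         h (B p (fin e) x₁ t)) (⊓-↓ a b q) ⟩
      ∑[ r ← y ⟪ fin b ∣ fin a ⟫ z ] ∑[ t ← x₂ ⟪ fin (a ⊓ b) ∣ q ⟫ r ]
        h (B p (fin ((a ⊓ b) ↓ q)) x₁ t)
        ≈⟨ ∑-cong (y ⟪ fin b ∣ fin a ⟫ z) (λ r → ∑-≺ x₂ r) ⟨
      ∑[ r ← y ⟪ fin b ∣ fin a ⟫ z ] ∑ (B p q x₁ x₂ ≺ᵗ[ fin (a ⊓ b) ] r) h
        ∎

    -- Mirror image of `≺ᵗ-≺ᵗ`: both sides vanish if `z` is a leaf, and otherwise the change takes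
    -- place in the left subtree of `z`.
    ≻ᵗ-≻ᵗ : ∀ (x : TreeOrLeaf γ k) (a : Label γ k) b (y : Tree γ) (z : TreeOrLeaf γ l) →
            ∑[ r ← x ⟪ fin b ∣ a ⟫ y ] ∑ (r ≻ᵗ[ fin (b ↓ a) ] z) h ≈ᴹ
            ∑[ r ← y ≻ᵗ[ fin b ] z ] ∑ (x ≻ᵗ[ a ] r) h
    ≻ᵗ-≻ᵗ x a b y ⊥ = ∑-0 (x ⟪ fin b ∣ a ⟫ y)
    ≻ᵗ-≻ᵗ ⊥ ∞ b y z@(B _ _ _ _) =
      ≈ᴹ-trans (∑-⊥≻ y) (≈ᴹ-sym (∑-cong (y ≻ᵗ[ fin b ] z) ∑-⊥≻))
    ≻ᵗ-≻ᵗ {h = h} x@(B _ _ _ _) (fin a) b y (B p q z₁ z₂) = begin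
      ∑[ r ← x ⟪ fin b ∣ fin a ⟫ y ] ∑ (r ≻ᵗ[ fin (b ⊓ a) ] B p q z₁ z₂) h
        ≈⟨ ∑-cong (x ⟪ fin b ∣ fin a ⟫ y) (λ r → ∑-≻ r z₁) ⟩
      ∑[ r ← x ⟪ fin b ∣ fin a ⟫ y ] ∑[ t ← r ⟪ p ∣ fin (b ⊓ a) ⟫ z₁ ]
        h (B (fin ((b ⊓ a) ↓ p)) q t z₂)
        ≈⟨ ⟪⟫-assoc x (fin a) b y p z₁ ⟩
      ∑[ t ← y ⟪ p ∣ fin b ⟫ z₁ ] ∑[ r ← x ⟪ fin (b ↓ p) ∣ fin a ⟫ t ]
        h (B (fin ((b ⊓ a) ↓ p)) q r z₂)
        ≡⟨ ≡.cong (λ e → ∑[ t ← y ⟪ p ∣ fin b ⟫ z₁ ] ∑[ r ← x ⟪ fin (b ↓ p) ∣ fin a ⟫ t ]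
                         h (B (fin e) q r z₂)) (⊓-↓ b a p) ⟨
      ∑[ t ← y ⟪ p ∣ fin b ⟫ z₁ ] ∑[ r ← x ⟪ fin (b ↓ p) ∣ fin a ⟫ t ]
        h (B (fin (a ⊓ (b ↓ p))) q r z₂)
        ≈⟨ ∑-cong (y ⟪ p ∣ fin b ⟫ z₁) (λ t → ∑-≻ x t) ⟨
      ∑[ t ← y ⟪ p ∣ fin b ⟫ z₁ ] ∑ (x ≻ᵗ[ fin a ] B (fin (b ↓ p)) q t z₂) h
        ≈⟨ ∑-≻ y z₁ ⟨
      ∑[ r ← y ≻ᵗ[ fin b ] B p q z₁ z₂ ] ∑ (x ≻ᵗ[ fin a ] r) h
        ∎

    -- Expanding the left side gives the left sides of the three axioms; their right sides regroup
    -- to the right side here. The mutual induction is well founded: the middle tree stays fixed,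
    -- and every cycle replaces `x` by its right subtree or `z` by its left subtree.
    ⟪⟫-assoc : ∀ (x : TreeOrLeaf γ k) (a : Label γ k) b (y : Tree γ)
                 (c : Label γ l) (z : TreeOrLeaf γ l) →
               ∑[ r ← x ⟪ fin b ∣ a ⟫ y ] ∑ (r ⟪ c ∣ fin (b ↓ a) ⟫ z) h ≈ᴹ
               ∑[ r ← y ⟪ c ∣ fin b ⟫ z ] ∑ (x ⟪ fin (b ↓ c) ∣ a ⟫ r) h
    ⟪⟫-assoc {h = h} x a b y c z = begin
      ∑[ r ← xy ] ∑ (r ⟪ c ∣ fin (b ↓ a) ⟫ z) h
        ≈⟨ ∑-cong xy (λ r → ∑-++ (r ≺ᵗ[ c ] z) _) ⟩
      ∑[ r ← xy ] (∑ (r ≺ᵗ[ c ] z) h +ᴹ ∑ (r ≻ᵗ[ fin (b ↓ a) ] z) h)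
        ≈⟨ ∑-+ xy ⟩
      (∑[ r ← xy ] ∑ (r ≺ᵗ[ c ] z) h) +ᴹ (∑[ r ← xy ] ∑ (r ≻ᵗ[ fin (b ↓ a) ] z) h)
        ≈⟨ +ᴹ-cong (∑-++ (x ≺ᵗ[ fin b ] y) _) (≻ᵗ-≻ᵗ x a b y z) ⟩
      (∑[ r ← x ≺ᵗ[ fin b ] y ] ∑ (r ≺ᵗ[ c ] z) h) +ᴹ
      (∑[ r ← x ≻ᵗ[ a ] y ] ∑ (r ≺ᵗ[ c ] z) h) +ᴹ
      (∑[ r ← y ≻ᵗ[ fin b ] z ] ∑ (x ≻ᵗ[ a ] r) h)
        ≈⟨ +ᴹ-congʳ (+ᴹ-cong (≺ᵗ-≺ᵗ x b y c z) (≻ᵗ-≺ᵗ x a y c z)) ⟩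
      (∑[ r ← yz ] ∑ (x ≺ᵗ[ fin (b ↓ c) ] r) h) +ᴹ
      (∑[ r ← y ≺ᵗ[ c ] z ] ∑ (x ≻ᵗ[ a ] r) h) +ᴹ
      (∑[ r ← y ≻ᵗ[ fin b ] z ] ∑ (x ≻ᵗ[ a ] r) h)
        ≈⟨ +ᴹ-assoc _ _ _ ⟩
      (∑[ r ← yz ] ∑ (x ≺ᵗ[ fin (b ↓ c) ] r) h) +ᴹ
      ((∑[ r ← y ≺ᵗ[ c ] z ] ∑ (x ≻ᵗ[ a ] r) h) +ᴹ
       (∑[ r ← y ≻ᵗ[ fin b ] z ] ∑ (x ≻ᵗ[ a ] r) h))
        ≈⟨ +ᴹ-congˡ (∑-++ (y ≺ᵗ[ c ] z) _) ⟨
      (∑[ r ← yz ] ∑ (x ≺ᵗ[ fin (b ↓ c) ] r) h) +ᴹ (∑[ r ← yz ] ∑ (x ≻ᵗ[ a ] r) h)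
        ≈⟨ ∑-+ yz ⟨
      ∑[ r ← yz ] (∑ (x ≺ᵗ[ fin (b ↓ c) ] r) h +ᴹ ∑ (x ≻ᵗ[ a ] r) h)
        ≈⟨ ∑-cong yz (λ r → ∑-++ (x ≺ᵗ[ fin (b ↓ c) ] r) _) ⟨
      ∑[ r ← yz ] ∑ (x ⟪ fin (b ↓ c) ∣ a ⟫ r) h
        ∎
      where
      xy = x ⟪ fin b ∣ a ⟫ y
      yz = y ⟪ c ∣ fin b ⟫ z

  -- The axioms summed over combinations of trees

  private
    ≺ᶠ ≻ᶠ : Fin γ → Tree γ → Tree γ → Combination
    ≺ᶠ a s t = s ≺ᵗ[ fin a ] t
    ≻ᶠ a s t = s ≻ᵗ[ fin a ] t

  ∑-≻-≺ : ∀ a b u v w → ∑ ((u ≻[ b ] v) ≺[ a ] w) h ≈ᴹ ∑ (u ≻[ b ] (v ≺[ a ] w)) h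
  ∑-≻-≺ {h = h} a b u v w = begin
    ∑ ((u ≻[ b ] v) ≺[ a ] w) h
      ≈⟨ ∑-bilinearˡ (≺ᶠ a) (≻ᶠ b) u v w ⟩
    ∑[ x ← u ] ∑[ y ← v ] ∑[ z ← w ] ∑[ r ← ≻ᶠ b x y ] ∑ (≺ᶠ a r z) h
      ≈⟨ ∑-cong u (λ x → ∑-cong v λ y → ∑-cong w λ z → ≻ᵗ-≺ᵗ x (fin b) y (fin a) z) ⟩
    ∑[ x ← u ] ∑[ y ← v ] ∑[ z ← w ] ∑[ r ← ≺ᶠ a y z ] ∑ (≻ᶠ b x r) h
      ≈⟨ ∑-bilinearʳ (≻ᶠ b) (≺ᶠ a) u v w ⟨
    ∑ (u ≻[ b ] (v ≺[ a ] w)) h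
      ∎

  ∑-≺-≺ : ∀ a b u v w →
          ∑ ((u ≺[ b ] v) ≺[ a ] w) h ≈ᴹ
          ∑ ((u ≺[ a ⊓ b ] (v ≺[ a ] w)) ++ (u ≺[ a ⊓ b ] (v ≻[ b ] w))) h
  -- The identity on trees yields the minimum in the order `b ⊓ a`, the axiom asks for `a ⊓ b`.
  ∑-≺-≺ {h = h} a b u v w rewrite Min.⊓-comm (Fin.≤-totalOrder γ) a b =
    begin
    ∑ ((u ≺[ b ] v) ≺[ a ] w) h
      ≈⟨ ∑-bilinearˡ (≺ᶠ a) (≺ᶠ b) u v w ⟩
    ∑[ x ← u ] ∑[ y ← v ] ∑[ z ← w ] ∑[ r ← ≺ᶠ b x y ] ∑ (≺ᶠ a r z) h
      ≈⟨ ∑-cong u (λ x → ∑-cong v λ y → ∑-cong w λ z → ≺ᵗ-≺ᵗ x b y (fin a) z) ⟩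
    ∑[ x ← u ] ∑[ y ← v ] ∑[ z ← w ] ∑[ r ← ≺ᶠ a y z ++ ≻ᶠ b y z ] ∑ (≺ᶠ (b ⊓ a) x r) h
      ≈⟨ ∑-cong u (λ x → ∑-cong v λ y → ∑-cong w λ z → ∑-++ (≺ᶠ a y z) (≻ᶠ b y z)) ⟩
    ∑[ x ← u ] ∑[ y ← v ] ∑[ z ← w ]
      ((∑[ r ← ≺ᶠ a y z ] ∑ (≺ᶠ (b ⊓ a) x r) h) +ᴹ
       (∑[ r ← ≻ᶠ b y z ] ∑ (≺ᶠ (b ⊓ a) x r) h))
      ≈⟨ ∑³-+ u v w ⟨
    (∑[ x ← u ] ∑[ y ← v ] ∑[ z ← w ] ∑[ r ← ≺ᶠ a y z ] ∑ (≺ᶠ (b ⊓ a) x r) h) +ᴹ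
    (∑[ x ← u ] ∑[ y ← v ] ∑[ z ← w ] ∑[ r ← ≻ᶠ b y z ] ∑ (≺ᶠ (b ⊓ a) x r) h)
      ≈⟨ +ᴹ-cong (∑-bilinearʳ (≺ᶠ (b ⊓ a)) (≺ᶠ a) u v w)
                 (∑-bilinearʳ (≺ᶠ (b ⊓ a)) (≻ᶠ b) u v w) ⟨
    ∑ p h +ᴹ ∑ q h
      ≈⟨ ∑-++ p q ⟨
    ∑ (p ++ q) h
      ∎
    where
    p = u ≺[ b ⊓ a ] (v ≺[ a ] w)
    q = u ≺[ b ⊓ a ] (v ≻[ b ] w)

  ∑-≻-≻ : ∀ a b u v w →
          ∑ (((u ≺[ b ] v) ≻[ a ⊓ b ] w) ++ ((u ≻[ a ] v) ≻[ a ⊓ b ] w)) h ≈ᴹ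
          ∑ (u ≻[ a ] (v ≻[ b ] w)) h
  ∑-≻-≻ {h = h} a b u v w rewrite Min.⊓-comm (Fin.≤-totalOrder γ) a b =
    begin
    ∑ (p ++ q) h
      ≈⟨ ∑-++ p q ⟩
    ∑ p h +ᴹ ∑ q h
      ≈⟨ +ᴹ-cong (∑-bilinearˡ (≻ᶠ (b ⊓ a)) (≺ᶠ b) u v w)
                 (∑-bilinearˡ (≻ᶠ (b ⊓ a)) (≻ᶠ a) u v w) ⟩
    (∑[ x ← u ] ∑[ y ← v ] ∑[ z ← w ] ∑[ r ← ≺ᶠ b x y ] ∑ (≻ᶠ (b ⊓ a) r z) h) +ᴹ
    (∑[ x ← u ] ∑[ y ← v ] ∑[ z ← w ] ∑[ r ← ≻ᶠ a x y ] ∑ (≻ᶠ (b ⊓ a) r z) h)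
      ≈⟨ ∑³-+ u v w ⟩
    ∑[ x ← u ] ∑[ y ← v ] ∑[ z ← w ]
      ((∑[ r ← ≺ᶠ b x y ] ∑ (≻ᶠ (b ⊓ a) r z) h) +ᴹ
       (∑[ r ← ≻ᶠ a x y ] ∑ (≻ᶠ (b ⊓ a) r z) h))
      ≈⟨ ∑-cong u (λ x → ∑-cong v λ y → ∑-cong w λ z → ∑-++ (≺ᶠ b x y) (≻ᶠ a x y)) ⟨
    ∑[ x ← u ] ∑[ y ← v ] ∑[ z ← w ] ∑[ r ← ≺ᶠ b x y ++ ≻ᶠ a x y ] ∑ (≻ᶠ (b ⊓ a) r z) h
      ≈⟨ ∑-cong u (λ x → ∑-cong v λ y → ∑-cong w λ z → ≻ᵗ-≻ᵗ x (fin a) b y z) ⟩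
    ∑[ x ← u ] ∑[ y ← v ] ∑[ z ← w ] ∑[ r ← ≻ᶠ b y z ] ∑ (≻ᶠ a x r) h
      ≈⟨ ∑-bilinearʳ (≻ᶠ a) (≻ᶠ b) u v w ⟨
    ∑ (u ≻[ a ] (v ≻[ b ] w)) h
      ∎
    where
    p = (u ≺[ b ] v) ≻[ b ⊓ a ] w
    q = (u ≻[ a ] v) ≻[ b ⊓ a ] w

-- The polydendriform structure on combinations of trees

module Axioms (K : HeytingField c ℓ₁ ℓ₂) (γ : ℕ) where

  open TreeAlgebra K γ
  open Products K γ vectorSpace
  open Sum K (_≟ᵀ_ {γ} {internal}) vectorSpace
  open Module vectorSpace
  open SetoidReasoning ≈ᴹ-setoid

  -- With `h = basis`, the identities proved after summing an arbitrary `h` become identities of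
  -- combinations.
  ∑-basis-injective : ∀ u v → ∑ u basis ≋ ∑ v basis → u ≋ v
  ∑-basis-injective u v eq = begin
    u          ≈⟨ basis-expansion K _≟ᵀ_ u ⟨
    ∑ u basis  ≈⟨ eq ⟩
    ∑ v basis  ≈⟨ basis-expansion K _≟ᵀ_ v ⟩
    v          ∎

  -- `bilinear` is defined on lists of entries; as an iterated sum it inherits linearity, including
  -- compatibility with `≋`, from `∑-linear`.
  bilinear-expansion : ∀ f u v → bilinear f u v ≋ ∑[ s ← u ] ∑[ t ← v ] ∑ (f s t) basis
  bilinear-expansion f u v = begin
    bilinear f u v                           ≈⟨ basis-expansion K _≟ᵀ_ (bilinear f u v) ⟨
    ∑ (bilinear f u v) basis                 ≈⟨ ∑-bilinear f u v ⟩
    ∑[ s ← u ] ∑[ t ← v ] ∑ (f s t) basis    ∎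

  isLinear-≈ : ∀ {F G} → (∀ u → F u ≋ G u) → IsLinear K vectorSpace vectorSpace G →
               IsLinear K vectorSpace vectorSpace F
  isLinear-≈ {F} {G} F≋G G-linear = mkLinear K vectorSpace vectorSpace
    (λ {u} {v} u≋v → begin
      F u  ≈⟨ F≋G u ⟩
      G u  ≈⟨ ⟦⟧-cong {u} {v} u≋v ⟩
      G v  ≈⟨ F≋G v ⟨
      F v  ∎)
    (λ u v → begin
      F (u ++ v)  ≈⟨ F≋G (u ++ v) ⟩
      G (u ++ v)  ≈⟨ +ᴹ-homo u v ⟩
      G u ++ G v  ≈⟨ +ᴹ-cong {F u} {G u} {F v} {G v} (F≋G u) (F≋G v) ⟨
      F u ++ F v  ∎)
    (λ r u → begin
      F (r ∙ u)  ≈⟨ F≋G (r ∙ u) ⟩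
      G (r ∙ u)  ≈⟨ *ₗ-homo r u ⟩
      r ∙ G u    ≈⟨ *ₗ-congˡ {r} {F u} {G u} (F≋G u) ⟨
      r ∙ F u    ∎)
    where open Linear K vectorSpace vectorSpace G-linear

  bilinear-linearˡ : ∀ f v → IsLinear K vectorSpace vectorSpace (λ u → bilinear f u v)
  bilinear-linearˡ f v = isLinear-≈ (λ u → bilinear-expansion f u v) ∑-linear

  bilinear-linearʳ : ∀ f u → IsLinear K vectorSpace vectorSpace (bilinear f u)
  bilinear-linearʳ f u = isLinear-≈ expansion ∑-linear
    where
    -- The sums are exchanged so that the variable argument `v` governs the outer one, as `∑-linear`
    -- requires.
    expansion : ∀ v → bilinear f u v ≋ ∑[ t ← v ] ∑[ s ← u ] ∑ (f s t) basis
    expansion v = begin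
      bilinear f u v                         ≈⟨ bilinear-expansion f u v ⟩
      ∑[ s ← u ] ∑[ t ← v ] ∑ (f s t) basis  ≈⟨ ∑-swap u v ⟩
      ∑[ t ← v ] ∑[ s ← u ] ∑ (f s t) basis  ∎

  isPolydendriform : IsPolydendriform K γ vectorSpace _≺[_]_ _≻[_]_
  isPolydendriform = record
    { ≺-linearˡ = λ a → bilinear-linearˡ (λ s t → s ≺ᵗ[ fin a ] t)
    ; ≺-linearʳ = λ a → bilinear-linearʳ (λ s t → s ≺ᵗ[ fin a ] t)
    ; ≻-linearˡ = λ a → bilinear-linearˡ (λ s t → s ≻ᵗ[ fin a ] t)
    ; ≻-linearʳ = λ a → bilinear-linearʳ (λ s t → s ≻ᵗ[ fin a ] t)
    ; ≻-≺ = λ a b u v w →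
        ∑-basis-injective ((u ≻[ b ] v) ≺[ a ] w) (u ≻[ b ] (v ≺[ a ] w)) (∑-≻-≺ a b u v w)
    ; ≺-≺ = λ a b u v w →
        ∑-basis-injective ((u ≺[ b ] v) ≺[ a ] w)
          ((u ≺[ a ⊓ b ] (v ≺[ a ] w)) ++ (u ≺[ a ⊓ b ] (v ≻[ b ] w))) (∑-≺-≺ a b u v w)
    ; ≻-≻ = λ a b u v w →
        ∑-basis-injective (((u ≺[ b ] v) ≻[ a ⊓ b ] w) ++ ((u ≻[ a ] v) ≻[ a ⊓ b ] w))
          (u ≻[ a ] (v ≻[ b ] w)) (∑-≻-≻ a b u v w)
    }

-- The universal property

module Evaluation (K : HeytingField c ℓ₁ ℓ₂) (γ : ℕ) (Q : PolydendriformAlgebra K γ m ℓ)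
                  (q : PolydendriformAlgebra.Carrierᴹ Q) where

  open PolydendriformAlgebra Q using (_≺[_]_; _≻[_]_; isPolydendriform)
    renaming (vectorSpace to W)
  open Module W
  open SetoidReasoning ≈ᴹ-setoid
  open IsPolydendriform isPolydendriform
  open TreeAlgebra K γ using (Combination; _≺ᵗ[_]_; _≻ᵗ[_]_; bilinear)
  open Sum K (_≟ᵀ_ {γ} {internal}) W
  open Products K γ W using (∑-≺; ∑-≻; ∑-⊥≻; ∑-≺⊥; _⟪_∣_⟫_)

  private
    variable
      k l : Kind

    module ≺ˡ a y = Linear K W W (≺-linearˡ a y)
    module ≺ʳ a x = Linear K W W (≺-linearʳ a x)
    module ≻ˡ a y = Linear K W W (≻-linearˡ a y)
    module ≻ʳ a x = Linear K W W (≻-linearʳ a x)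

  -- Factors that are leaves, recognised by the label ∞, are absent.
  mutual
    eval : Tree γ → Carrierᴹ
    eval (B x y t₁ t₂) = evalˡ x t₁ (evalʳ y t₂ q)

    evalˡ : Label γ k → TreeOrLeaf γ k → Carrierᴹ → Carrierᴹ
    evalˡ ∞       _ w = w
    evalˡ (fin a) t w = eval t ≻[ a ] w

    evalʳ : Label γ k → TreeOrLeaf γ k → Carrierᴹ → Carrierᴹ
    evalʳ ∞       _ w = w
    evalʳ (fin a) t w = w ≺[ a ] eval t

  evalˡ-cong : ∀ (x : Label γ k) t {v w} → v ≈ᴹ w → evalˡ x t v ≈ᴹ evalˡ x t w
  evalˡ-cong ∞       t v≈w = v≈w
  evalˡ-cong (fin a) t v≈w = ≻ʳ.⟦⟧-cong a (eval t) v≈w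

  evalʳ-cong : ∀ (x : Label γ k) t {v w} → v ≈ᴹ w → evalʳ x t v ≈ᴹ evalʳ x t w
  evalʳ-cong ∞       t v≈w = v≈w
  evalʳ-cong (fin a) t v≈w = ≺ˡ.⟦⟧-cong a (eval t) v≈w

  evalˡ-∑ : ∀ (x : Label γ k) t u {h} → evalˡ x t (∑ u h) ≈ᴹ ∑ u (evalˡ x t ∘ h)
  evalˡ-∑ ∞       t u = ≈ᴹ-refl
  evalˡ-∑ (fin a) t u = linear-∑ K _≟ᵀ_ (≻-linearʳ a (eval t)) u

  -- The first axiom of `Q`: a left factor does not interfere with multiplication from the right.
  evalˡ-≺ : ∀ (x : Label γ k) t a v w → evalˡ x t v ≺[ a ] w ≈ᴹ evalˡ x t (v ≺[ a ] w)
  evalˡ-≺ ∞       t a v w = ≈ᴹ-refl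
  evalˡ-≺ (fin b) t a v w = ≻-≺ a b (eval t) v w

  mutual

    -- The product alters only the right factor of `q`. Linearity gathers the sum inside that
    -- factor, the second axiom of `Q` at `q` splits it into two successive right multiplications,
    -- and `evalˡ-≺` takes the last one outside.
    eval-≺ : ∀ a s t → ∑ (s ≺ᵗ[ fin a ] t) eval ≈ᴹ (eval s ≺[ a ] eval t)
    eval-≺ a (B x y t₁ t₂) t = begin
      ∑ (B x y t₁ t₂ ≺ᵗ[ fin a ] t) eval
        ≈⟨ ∑-≺ t₂ t ⟩
      ∑[ r ← t₂ ⟪ fin a ∣ y ⟫ t ] evalˡ x t₁ (q ≺[ a ↓ y ] eval r)
        ≈⟨ evalˡ-∑ x t₁ (t₂ ⟪ fin a ∣ y ⟫ t) ⟨
      evalˡ x t₁ (∑[ r ← t₂ ⟪ fin a ∣ y ⟫ t ] (q ≺[ a ↓ y ] eval r))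
        ≈⟨ evalˡ-cong x t₁ (linear-∑ K _≟ᵀ_ (≺-linearʳ (a ↓ y) q) (t₂ ⟪ fin a ∣ y ⟫ t)) ⟨
      evalˡ x t₁ (q ≺[ a ↓ y ] ∑ (t₂ ⟪ fin a ∣ y ⟫ t) eval)
        ≈⟨ evalˡ-cong x t₁ (right y t₂) ⟩
      evalˡ x t₁ (evalʳ y t₂ q ≺[ a ] eval t)
        ≈⟨ evalˡ-≺ x t₁ a (evalʳ y t₂ q) (eval t) ⟨
      evalˡ x t₁ (evalʳ y t₂ q) ≺[ a ] eval t
        ∎
      where
      right : (y : Label γ l) (t₂ : TreeOrLeaf γ l) →
              (q ≺[ a ↓ y ] ∑ (t₂ ⟪ fin a ∣ y ⟫ t) eval) ≈ᴹ (evalʳ y t₂ q ≺[ a ] eval t)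
      -- For a leaf, the `≺` part of the new subtree is zero and the `≻` part is `t`, so no axiom is
      -- involved.
      right ∞       ⊥  = ≺ʳ.⟦⟧-cong a q (∑-⊥≻ t)
      right (fin b) t₂ = begin
        q ≺[ a ⊓ b ] ∑ (t₂ ⟪ fin a ∣ fin b ⟫ t) eval
          ≈⟨ ≺ʳ.⟦⟧-cong (a ⊓ b) q (∑-++ (t₂ ≺ᵗ[ fin a ] t) (t₂ ≻ᵗ[ fin b ] t)) ⟩
        q ≺[ a ⊓ b ] (∑ (t₂ ≺ᵗ[ fin a ] t) eval +ᴹ ∑ (t₂ ≻ᵗ[ fin b ] t) eval)
          ≈⟨ ≺ʳ.⟦⟧-cong (a ⊓ b) q (+ᴹ-cong (eval-≺ a t₂ t) (eval-≻ b t₂ t)) ⟩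
        q ≺[ a ⊓ b ] ((eval t₂ ≺[ a ] eval t) +ᴹ (eval t₂ ≻[ b ] eval t))
          ≈⟨ ≺ʳ.+ᴹ-homo (a ⊓ b) q _ _ ⟩
        (q ≺[ a ⊓ b ] (eval t₂ ≺[ a ] eval t)) +ᴹ (q ≺[ a ⊓ b ] (eval t₂ ≻[ b ] eval t))
          ≈⟨ ≺-≺ a b q (eval t₂) (eval t) ⟨
        (q ≺[ b ] eval t₂) ≺[ a ] eval t
          ∎

    -- Here the altered left factor is outermost, so the third axiom of `Q` suffices, with `q` and
    -- its right factor together as the third argument.
    eval-≻ : ∀ a s t → ∑ (s ≻ᵗ[ fin a ] t) eval ≈ᴹ (eval s ≻[ a ] eval t)
    eval-≻ a s (B x y t₁ t₂) = begin
      ∑ (s ≻ᵗ[ fin a ] B x y t₁ t₂) eval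
        ≈⟨ ∑-≻ s t₁ ⟩
      ∑[ r ← s ⟪ x ∣ fin a ⟫ t₁ ] (eval r ≻[ a ↓ x ] w)
        ≈⟨ linear-∑ K _≟ᵀ_ (≻-linearˡ (a ↓ x) w) (s ⟪ x ∣ fin a ⟫ t₁) ⟨
      ∑ (s ⟪ x ∣ fin a ⟫ t₁) eval ≻[ a ↓ x ] w
        ≈⟨ left x t₁ ⟩
      eval s ≻[ a ] evalˡ x t₁ w
        ∎
      where
      w = evalʳ y t₂ q

      left : (x : Label γ k) (t₁ : TreeOrLeaf γ k) →
             (∑ (s ⟪ x ∣ fin a ⟫ t₁) eval ≻[ a ↓ x ] w) ≈ᴹ (eval s ≻[ a ] evalˡ x t₁ w)
      left ∞       ⊥  = ≻ˡ.⟦⟧-cong a w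
        (≈ᴹ-trans (∑-++ (s ≺ᵗ[ ∞ ] ⊥) []) (≈ᴹ-trans (+ᴹ-identityʳ _) (∑-≺⊥ s)))
      left (fin b) t₁ = begin
        ∑ (s ⟪ fin b ∣ fin a ⟫ t₁) eval ≻[ a ⊓ b ] w
          ≈⟨ ≻ˡ.⟦⟧-cong (a ⊓ b) w (∑-++ (s ≺ᵗ[ fin b ] t₁) (s ≻ᵗ[ fin a ] t₁)) ⟩
        (∑ (s ≺ᵗ[ fin b ] t₁) eval +ᴹ ∑ (s ≻ᵗ[ fin a ] t₁) eval) ≻[ a ⊓ b ] w
          ≈⟨ ≻ˡ.⟦⟧-cong (a ⊓ b) w (+ᴹ-cong (eval-≺ b s t₁) (eval-≻ a s t₁)) ⟩
        ((eval s ≺[ b ] eval t₁) +ᴹ (eval s ≻[ a ] eval t₁)) ≻[ a ⊓ b ] w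
          ≈⟨ ≻ˡ.+ᴹ-homo (a ⊓ b) w _ _ ⟩
        ((eval s ≺[ b ] eval t₁) ≻[ a ⊓ b ] w) +ᴹ ((eval s ≻[ a ] eval t₁) ≻[ a ⊓ b ] w)
          ≈⟨ ≻-≻ a b (eval s) (eval t₁) w ⟩
        eval s ≻[ a ] (eval t₁ ≻[ b ] w)
          ∎

  ∑-eval-homo : ∀ (f : Tree γ → Tree γ → Combination) (_*_ : Carrierᴹ → Carrierᴹ → Carrierᴹ) →
                (∀ y → IsLinear K W W (_* y)) → (∀ x → IsLinear K W W (x *_)) →
                (∀ s t → ∑ (f s t) eval ≈ᴹ (eval s * eval t)) →
                ∀ u v → ∑ (bilinear f u v) eval ≈ᴹ (∑ u eval * ∑ v eval)
  ∑-eval-homo f _*_ linearˡ linearʳ homo u v = begin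
    ∑ (bilinear f u v) eval
      ≈⟨ ∑-bilinear f u v ⟩
    ∑[ s ← u ] ∑[ t ← v ] ∑ (f s t) eval
      ≈⟨ ∑-cong u (λ s → ∑-cong v (homo s)) ⟩
    ∑[ s ← u ] ∑[ t ← v ] (eval s * eval t)
      ≈⟨ ∑-cong u (λ s → linear-∑ K _≟ᵀ_ (linearʳ (eval s)) v) ⟨
    ∑[ s ← u ] (eval s * ∑ v eval)
      ≈⟨ linear-∑ K _≟ᵀ_ (linearˡ (∑ v eval)) u ⟨
    ∑ u eval * ∑ v eval
      ∎

-- Generation by the one-node tree, existence and uniqueness of morphisms

module _ (K : HeytingField c ℓ₁ ℓ₂) (γ : ℕ) where

  open TreeAlgebra K γ
  open Axioms K γ
  open IsPolydendriform isPolydendriform using (≺-linearʳ; ≻-linearˡ)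
  open Module vectorSpace
  open SetoidReasoning ≈ᴹ-setoid
  open Sum K (_≟ᵀ_ {γ} {internal}) vectorSpace
  open Products K γ vectorSpace using (∑-≺; ∑-≻; ∑-⊥≻; ∑-≺⊥)

  treeAlgebra : PolydendriformAlgebra K γ _ _
  treeAlgebra = record { isPolydendriform = isPolydendriform }

  ● : Tree γ
  ● = B ∞ ∞ ⊥ ⊥

  private module Trees = Evaluation K γ treeAlgebra (basis ●)

  bilinear-basis : ∀ f s t → bilinear f (basis s) (basis t) ≋ ∑ (f s t) basis
  bilinear-basis f s t = begin
    bilinear f (basis s) (basis t)
      ≈⟨ bilinear-expansion f (basis s) (basis t) ⟩
    ∑[ s ← basis s ] ∑[ t ← basis t ] ∑ (f s t) basis
      ≈⟨ ∑-basis {h = λ s → ∑[ t ← basis t ] ∑ (f s t) basis} s ⟩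
    ∑[ t ← basis t ] ∑ (f s t) basis
      ≈⟨ ∑-basis {h = λ t → ∑ (f s t) basis} t ⟩
    ∑ (f s t) basis
      ∎

  -- Evaluation at `●` in the tree algebra itself rebuilds the tree: a right factor is grafted onto
  -- the right leaf of `●`, then a left factor onto the remaining left leaf. Hence `●` generates the
  -- algebra.
  eval-basis : ∀ t → Trees.eval t ≋ basis t
  eval-basis (B x y t₁ t₂) = begin
    Trees.evalˡ x t₁ (Trees.evalʳ y t₂ (basis ●))
      ≈⟨ Trees.evalˡ-cong x t₁ {Trees.evalʳ y t₂ (basis ●)} (right y t₂) ⟩
    Trees.evalˡ x t₁ (basis (B ∞ y ⊥ t₂))
      ≈⟨ left x t₁ ⟩
    basis (B x y t₁ t₂)
      ∎
    where
    right : ∀ {k} (y : Label γ k) (t : TreeOrLeaf γ k) →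
            Trees.evalʳ y t (basis ●) ≋ basis (B ∞ y ⊥ t)
    right ∞       ⊥ = ≈ᴹ-refl {basis ●}
    right (fin a) t = begin
      basis ● ≺[ a ] Trees.eval t
        ≈⟨ Linear.⟦⟧-cong K vectorSpace vectorSpace (≺-linearʳ a (basis ●))
             {Trees.eval t} {basis t} (eval-basis t) ⟩
      basis ● ≺[ a ] basis t
        ≈⟨ bilinear-basis (λ s t → s ≺ᵗ[ fin a ] t) ● t ⟩
      ∑ (● ≺ᵗ[ fin a ] t) basis
        -- The right subtree of `●` is a leaf: its `≺` part is empty, and the new edge gets the
        -- label `a ↓ ∞`, which is `a`.
        ≈⟨ ∑-≺ ⊥ t ⟩
      ∑[ r ← ⊥ ≻ᵗ[ ∞ ] t ] basis (B ∞ (fin a) ⊥ r)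
        ≈⟨ ∑-⊥≻ {h = λ r → basis (B ∞ (fin a) ⊥ r)} t ⟩
      basis (B ∞ (fin a) ⊥ t)
        ∎

    left : ∀ {k} (x : Label γ k) (t : TreeOrLeaf γ k) →
           Trees.evalˡ x t (basis (B ∞ y ⊥ t₂)) ≋ basis (B x y t t₂)
    left ∞       ⊥ = ≈ᴹ-refl {basis (B ∞ y ⊥ t₂)}
    left (fin a) t = begin
      Trees.eval t ≻[ a ] w
        ≈⟨ Linear.⟦⟧-cong K vectorSpace vectorSpace (≻-linearˡ a w)
             {Trees.eval t} {basis t} (eval-basis t) ⟩
      basis t ≻[ a ] w
        ≈⟨ bilinear-basis (λ s t → s ≻ᵗ[ fin a ] t) t (B ∞ y ⊥ t₂) ⟩
      ∑ (t ≻ᵗ[ fin a ] B ∞ y ⊥ t₂) basis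
        ≈⟨ ∑-≻ t ⊥ ⟩
      ∑ (t ≺ᵗ[ ∞ ] ⊥ ++ []) h
        ≈⟨ ∑-++ (t ≺ᵗ[ ∞ ] ⊥) [] ⟩
      ∑ (t ≺ᵗ[ ∞ ] ⊥) h +ᴹ 0ᴹ
        ≈⟨ +ᴹ-identityʳ (∑ (t ≺ᵗ[ ∞ ] ⊥) h) ⟩
      ∑ (t ≺ᵗ[ ∞ ] ⊥) h
        ≈⟨ ∑-≺⊥ {h = h} t ⟩
      basis (B (fin a) y t t₂)
        ∎
      where
      w = basis (B ∞ y ⊥ t₂)
      h = λ r → basis (B (fin a) y r t₂)

  module _ (Q : PolydendriformAlgebra K γ m ℓ) (q : PolydendriformAlgebra.Carrierᴹ Q) where

    private
      module Q = PolydendriformAlgebra Q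
      module W = Module Q.vectorSpace
      module Eval = Evaluation K γ Q q
      module ∑Q = Sum K (_≟ᵀ_ {γ} {internal}) Q.vectorSpace
      module QP = IsPolydendriform Q.isPolydendriform

    evaluation : Morphism treeAlgebra Q
    evaluation = record
      { ⟦_⟧      = λ u → ∑Q.∑ u Eval.eval
      ; isLinear = ∑Q.∑-linear
      ; ≺-homo   = λ a → Eval.∑-eval-homo (λ s t → s ≺ᵗ[ fin a ] t) (λ x y → x Q.≺[ a ] y)
                              (QP.≺-linearˡ a) (QP.≺-linearʳ a) (Eval.eval-≺ a)
      ; ≻-homo   = λ a → Eval.∑-eval-homo (λ s t → s ≻ᵗ[ fin a ] t) (λ x y → x Q.≻[ a ] y)
                              (QP.≻-linearˡ a) (QP.≻-linearʳ a) (Eval.eval-≻ a)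
      }

    module _ (φ : Morphism treeAlgebra Q)
             (φ-generator : Morphism.⟦_⟧ φ (basis ●) Q.≈ᴹ q) where

      open Morphism φ
      private module φ = Linear K vectorSpace Q.vectorSpace isLinear

      mutual
        -- `eval` is built from the generator by the operations alone, and a morphism preserves
        -- these.
        eval-natural : ∀ t → ⟦ Trees.eval t ⟧ Q.≈ᴹ Eval.eval t
        eval-natural (B x y t₁ t₂) = W.≈ᴹ-trans (evalˡ-natural x t₁ (Trees.evalʳ y t₂ (basis ●)))
          (Eval.evalˡ-cong x t₁ (W.≈ᴹ-trans (evalʳ-natural y t₂ (basis ●))
          (Eval.evalʳ-cong y t₂ φ-generator)))

        evalˡ-natural : ∀ {k} (x : Label γ k) t u →
                        ⟦ Trees.evalˡ x t u ⟧ Q.≈ᴹ Eval.evalˡ x t ⟦ u ⟧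
        evalˡ-natural ∞       t u = W.≈ᴹ-refl
        evalˡ-natural (fin a) t u = W.≈ᴹ-trans (≻-homo a (Trees.eval t) u)
          (Linear.⟦⟧-cong K Q.vectorSpace Q.vectorSpace (QP.≻-linearˡ a ⟦ u ⟧) (eval-natural t))

        evalʳ-natural : ∀ {k} (x : Label γ k) t u →
                        ⟦ Trees.evalʳ x t u ⟧ Q.≈ᴹ Eval.evalʳ x t ⟦ u ⟧
        evalʳ-natural ∞       t u = W.≈ᴹ-refl
        evalʳ-natural (fin a) t u = W.≈ᴹ-trans (≺-homo a u (Trees.eval t))
          (Linear.⟦⟧-cong K Q.vectorSpace Q.vectorSpace (QP.≺-linearʳ a ⟦ u ⟧) (eval-natural t))

      -- By linearity it is enough to compare the values on single trees. By `eval-basis` each tree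
      -- is an evaluation at `●`, and `eval-natural` computes its image under `φ`.
      evaluation-unique : evaluation ≗ᴹ φ
      evaluation-unique u =
        W.≈ᴹ-trans (∑Q.∑-cong u (λ t → W.≈ᴹ-sym (eval-natural t)))
        (W.≈ᴹ-trans (∑Q.∑-cong u (λ t → φ.⟦⟧-cong {Trees.eval t} {basis t} (eval-basis t)))
        (W.≈ᴹ-trans (W.≈ᴹ-sym (linear-∑ K _≟ᵀ_ isLinear u))
        (φ.⟦⟧-cong {∑ u basis} {u} (basis-expansion K _≟ᵀ_ u))))

  isFreePolydendriform : IsFreePolydendriformOnOneGenerator K γ vectorSpace _≺[_]_ _≻[_]_
  isFreePolydendriform = record
    { isPolydendriform = isPolydendriform
    ; generator        = basis ●
    ; universal        = λ Q q →
        evaluation Q q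
      , Sum.∑-basis K _≟ᵀ_ (PolydendriformAlgebra.vectorSpace Q) {h = Evaluation.eval K γ Q q} ●
      , λ {φ} φ-generator → evaluation-unique Q q φ φ-generator
    }

theorem4p2p3 : ∀ {c ℓ₁ ℓ₂} (K : HeytingField c ℓ₁ ℓ₂) → CharacteristicZero K →
    (γ : ℕ) (let open TreeAlgebra K γ) →
    IsFreePolydendriformOnOneGenerator K γ vectorSpace _≺[_]_ _≻[_]_
theorem4p2p3 K _ γ = isFreePolydendriform K γ
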